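{- Let $p$ be an odd prime, write $\mathbb{F}_p=\{0,a_1,\ldots,a_{p-1}\}$ for the finite field with $p$ elements, and let $\chi=\left(\frac{\cdot}{p}\right)$ be the quadratic character of $\mathbb{F}_p$. Let $$S_p=\left[(a_i^2+a_ia_j+a_j^2)\,\chi(a_i^2+a_ia_j+a_j^2)\right]_{1\le i,j\le p-1},$$ a $(p-1)\times(p-1)$ matrix over $\mathbb{F}_p$. Suppose $p\nmid\det S_p$ (that is, $\det S_p\neq 0$ in $\mathbb{F}_p$). Then $$\left(\frac{\det S_p}{p}\right)=\left(\frac{T_{\frac{p+1}{2}}}{p}\right).$$
   Context: The elements $a_1,\ldots,a_{p-1}$ are the nonzero elements of $\mathbb{F}_p$, listed without repetition. $\left(\frac{\cdot}{p}\right)$ is the Legendre symbol, which depends only on the residue class modulo $p$ and so is also defined on elements of $\mathbb{F}_p$; thus $\chi(0)=0$, $\chi(x)=1$ if $x$ is a nonzero square in $\mathbb{F}_p$, and $\chi(x)=-1$ otherwise, and in the entries of $S_p$ these values are regarded as elements of $\mathbb{F}_p$. For a non-negative integer $n$, the central trinomial coefficient $T_n$ is the coefficient of $x^n$ in $(x^2+x+1)^n\in\mathbb{Z}[x]$, equivalently the constant term of $(x+1+x^{ -1})^n$.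
   Formalization: The prime p = 3 is excluded, because the claim fails there: det S_3 ≡ 2 (mod 3) is nonzero with Legendre symbol −1, while T_2 = 3 has symbol 0. -}

module Defs where

open import Algebra.Bundles using (CommutativeRing)
import Algebra.Properties.Semiring.Exp as SemiringExp
import Algebra.Properties.Semiring.Sum as SemiringSum
open import Data.Bool using (if_then_else_)
open import Data.Fin using (Fin; zero; suc; toℕ; punchIn)
open import Data.Fin.Properties using (any?)
open import Data.Integer using (ℤ; +_; -_; _+_; _-_; _*_; 0ℤ; 1ℤ; -1ℤ)
open import Data.Integer.Divisibility.Signed
  using (_∣_; _∣?_; divides; ∣m∣n⇒∣m+n; ∣m⇒∣-m; ∣m⇒∣m*n; ∣n⇒∣m*n)
open import Data.Integer.Properties using (+-*-commutativeRing; +-inverseʳ)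
open import Data.Integer.Tactic.RingSolver using (solve-∀)
open import Data.List using (List; []; _∷_; map)
open import Data.Nat using (ℕ; zero; suc; _∸_)
open import Data.Product using (∃-syntax; _,_)
open import Level using (0ℓ)
open import Relation.Binary.Structures using (IsEquivalence)
open import Relation.Binary.PropositionalEquality
  using (_≡_; refl; subst)
open import Relation.Nullary using (¬_; does)

-- ℤ with congruence modulo p as its setoid equality; for p prime this is 𝔽ₚ.

infix 4 _≡_[mod_]

record _≡_[mod_] (x y : ℤ) (p : ℕ) : Set where
  constructor congruent
  field
    divisible : + p ∣ x - y

private
  module ℤ-ring = CommutativeRing +-*-commutativeRing

  ≡⇒≡mod : ∀ {p x y} → x ≡ y → x ≡ y [mod p ]
  ≡⇒≡mod {x = x} refl = congruent (divides 0ℤ (+-inverseʳ x))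

  ≡mod-sym : ∀ {p x y} → x ≡ y [mod p ] → y ≡ x [mod p ]
  ≡mod-sym {p} {x} {y} (congruent d) = congruent (subst (+ p ∣_) (eq x y) (∣m⇒∣-m d))
    where
    eq : ∀ x y → - (x - y) ≡ y - x
    eq = solve-∀

  ≡mod-trans : ∀ {p x y z} →
               x ≡ y [mod p ] → y ≡ z [mod p ] → x ≡ z [mod p ]
  ≡mod-trans {p} {x} {y} {z} (congruent d) (congruent e) =
    congruent (subst (+ p ∣_) (eq x y z) (∣m∣n⇒∣m+n d e))
    where
    eq : ∀ x y z → (x - y) + (y - z) ≡ x - z
    eq = solve-∀

  +-cong-mod : ∀ {p x y u v} → x ≡ y [mod p ] → u ≡ v [mod p ] →
               x + u ≡ y + v [mod p ]
  +-cong-mod {p} {x} {y} {u} {v} (congruent d) (congruent e) =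
    congruent (subst (+ p ∣_) (eq x y u v) (∣m∣n⇒∣m+n d e))
    where
    eq : ∀ x y u v → (x - y) + (u - v) ≡ (x + u) - (y + v)
    eq = solve-∀

  *-cong-mod : ∀ {p x y u v} → x ≡ y [mod p ] → u ≡ v [mod p ] →
               x * u ≡ y * v [mod p ]
  *-cong-mod {p} {x} {y} {u} {v} (congruent d) (congruent e) =
    congruent (subst (+ p ∣_) (eq x y u v) (∣m∣n⇒∣m+n (∣m⇒∣m*n u d) (∣n⇒∣m*n y e)))
    where
    eq : ∀ x y u v → (x - y) * u + y * (u - v) ≡ x * u - y * v
    eq = solve-∀

  -‿cong-mod : ∀ {p x y} → x ≡ y [mod p ] → - x ≡ - y [mod p ]
  -‿cong-mod {p} {x} {y} (congruent d) = congruent (subst (+ p ∣_) (eq x y) (∣m⇒∣-m d))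
    where
    eq : ∀ x y → - (x - y) ≡ (- x) - (- y)
    eq = solve-∀

𝔽 : ℕ → CommutativeRing 0ℓ 0ℓ
𝔽 p = record
  { Carrier = ℤ
  ; _≈_ = _≡_[mod p ]
  ; _+_ = _+_
  ; _*_ = _*_
  ; -_ = -_
  ; 0# = 0ℤ
  ; 1# = 1ℤ
  ; isCommutativeRing = record
    { isRing = record
      { +-isAbelianGroup = record
        { isGroup = record
          { isMonoid = record
            { isSemigroup = record
              { isMagma = record
                { isEquivalence = isEquivalence
                ; ∙-cong = +-cong-mod
                }
              ; assoc = λ x y z → ≡⇒≡mod (ℤ-ring.+-assoc x y z)
              }
            ; identity = (λ x → ≡⇒≡mod (ℤ-ring.+-identityˡ x))
                       , (λ x → ≡⇒≡mod (ℤ-ring.+-identityʳ x))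
            }
          ; inverse = (λ x → ≡⇒≡mod (ℤ-ring.-‿inverseˡ x))
                    , (λ x → ≡⇒≡mod (ℤ-ring.-‿inverseʳ x))
          ; ⁻¹-cong = -‿cong-mod
          }
        ; comm = λ x y → ≡⇒≡mod (ℤ-ring.+-comm x y)
        }
      ; *-cong = *-cong-mod
      ; *-assoc = λ x y z → ≡⇒≡mod (ℤ-ring.*-assoc x y z)
      ; *-identity = (λ x → ≡⇒≡mod (ℤ-ring.*-identityˡ x))
                   , (λ x → ≡⇒≡mod (ℤ-ring.*-identityʳ x))
      ; distrib = (λ x y z → ≡⇒≡mod (ℤ-ring.distribˡ x y z))
                , (λ x y z → ≡⇒≡mod (ℤ-ring.distribʳ x y z))
      }
    ; *-comm = λ x y → ≡⇒≡mod (ℤ-ring.*-comm x y)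
    }
  }
  where
  isEquivalence : IsEquivalence _≡_[mod p ]
  isEquivalence = record
    { refl = ≡⇒≡mod refl ; sym = ≡mod-sym ; trans = ≡mod-trans }

module Determinant {c ℓ} (R : CommutativeRing c ℓ) where
  open CommutativeRing R using (Carrier; 1#; semiring)
    renaming (_*_ to _·_; -_ to ⊖_)
  open SemiringExp semiring using (_^_)
  open SemiringSum semiring using (sum)

  -- Laplace expansion along the first row.
  det : ∀ {n} → (Fin n → Fin n → Carrier) → Carrier
  det {zero}  A = 1#
  det {suc n} A = sum λ j →
    (((⊖ 1#) ^ toℕ j) · A zero j) · det (λ i k → A (suc i) (punchIn j k))

-- It suffices to look for a square root among the representatives 0, …, p - 1.
legendre : ℕ → ℤ → ℤ
legendre p x =
  if does (+ p ∣? x) then 0ℤ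
  else if does (any? λ (y : Fin p) → + p ∣? (+ toℕ y * + toℕ y - x)) then 1ℤ
  else -1ℤ

record ListsNonzero (p : ℕ) (a : Fin (p ∸ 1) → ℤ) : Set where
  field
    nonzero    : ∀ i → ¬ (a i ≡ 0ℤ [mod p ])
    distinct   : ∀ i j → a i ≡ a j [mod p ] → i ≡ j
    exhaustive : ∀ x → ¬ (x ≡ 0ℤ [mod p ]) → ∃[ i ] a i ≡ x [mod p ]

S : (p : ℕ) → (Fin (p ∸ 1) → ℤ) → Fin (p ∸ 1) → Fin (p ∸ 1) → ℤ
S p a i j = q * legendre p q
  where
  q = a i * a i + a i * a j + a j * a j

detS : (p : ℕ) → (Fin (p ∸ 1) → ℤ) → ℤ
detS p a = Determinant.det (𝔽 p) (S p a)

-- Polynomials over ℤ as coefficient lists, constant term first.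

Poly : Set
Poly = List ℤ

infixl 6 _+ᴾ_
infixl 7 _*ᴾ_
infixr 8 _^ᴾ_

_+ᴾ_ : Poly → Poly → Poly
[]       +ᴾ g        = g
(a ∷ f)  +ᴾ []       = a ∷ f
(a ∷ f)  +ᴾ (b ∷ g)  = (a + b) ∷ (f +ᴾ g)

_*ᴾ_ : Poly → Poly → Poly
[]      *ᴾ g = []
(a ∷ f) *ᴾ g = map (a *_) g +ᴾ (0ℤ ∷ (f *ᴾ g))

_^ᴾ_ : Poly → ℕ → Poly
f ^ᴾ zero  = 1ℤ ∷ []
f ^ᴾ suc n = f *ᴾ (f ^ᴾ n)

coeff : Poly → ℕ → ℤ
coeff []      _       = 0ℤ
coeff (a ∷ f) zero    = a
coeff (a ∷ f) (suc n) = coeff f n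

T : ℕ → ℤ
T n = coeff ((1ℤ ∷ 1ℤ ∷ 1ℤ ∷ []) ^ᴾ n) n

-- At p = 3, with the listing 1, 2 of the nonzero elements, the symbols of det S₃
-- and T₂ differ although 3 ∤ det S₃: the identity
-- legendre p (detS p a) ≡ legendre p (T ((p + 1) / 2)) needs p ≢ 3.
module p=3 where
  a : Fin 2 → ℤ
  a i = + suc (toℕ i)

  legendre-detS : legendre 3 (detS 3 a) ≡ -1ℤ
  legendre-detS = refl

  legendre-T : legendre 3 (T 2) ≡ 0ℤ
  legendre-T = refl

{-# OPTIONS --safe #-}

-- Put n = (p + 1) / 2. By Euler's criterion q χ(q) = qⁿ in 𝔽ₚ. Expanding (x² + xy + y²)ⁿ in
-- trinomial coefficients and reducing exponents modulo p - 1 to 1, …, p - 1 gives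
-- Sₚ = V M Vᵀ with V = (aᵢᵏ), where M is a 1 × 1 block 2 n = 1 next to an antidiagonal block
-- whose entries form a palindrome with centre Tₙ (here p > 3 is needed). Hence
-- det Sₚ = w² (-1)^h Tₙ with h = (p - 3) / 2. Raising this to the power h + 1 = (p - 1) / 2
-- removes w² by Fermat's theorem and the sign because h (h + 1) is even, and Euler's
-- criterion gives the claim. The facts about determinants come from the uniqueness of
-- alternating forms, applied to the determinant as a function of the columns.

module Submission where

open import Defs
open import Algebra.Bundles using (CommutativeRing)
import Algebra.Properties.CommutativeMonoid.Sum as MonoidSum
import Algebra.Properties.CommutativeSemiring.Binomial as Binomial
import Algebra.Properties.CommutativeSemiring.Exp as CommutativeSemiringExp
import Algebra.Properties.Ring as RingProperties
import Algebra.Properties.Semiring.Exp as SemiringExp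
import Algebra.Properties.Semiring.Mult as SemiringMult
import Algebra.Properties.Semiring.Sum as SemiringSum
import Algebra.Solver.Ring.NaturalCoefficients.Default as SemiringSolver
open import Data.Bool using (Bool; if_then_else_)
open import Data.Empty using (⊥-elim)
open import Data.Fin
  using (Fin; zero; suc; toℕ; fromℕ; fromℕ<; inject₁; opposite; punchIn; punchOut)
open import Data.Fin.Properties
  using ( _≟_; any?; 0≢1+n; suc-injective; toℕ<n; toℕ-fromℕ; toℕ-fromℕ<; toℕ-inject₁; toℕ-injective
        ; punchInᵢ≢i; punchIn-injective; punchIn-punchOut; opposite-prop; opposite-involutive)
open import Data.Integer as ℤ using (ℤ; +_; 0ℤ; 1ℤ; -1ℤ; ∣_∣)
import Data.Integer.Divisibility.Signed as ℤ∣
import Data.Integer.DivMod as ℤ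
import Data.Integer.Properties as ℤ
open import Data.Integer.Tactic.RingSolver using (solve-∀)
open import Data.Nat as ℕ using (ℕ; zero; suc; _∸_; _≤_; _<_; s≤s; z≤n; _!)
open import Data.Nat.Combinatorics using (_C_; nCn≡1; nCk≡n!/k![n-k]!; k![n∸k]!∣n!)
open import Data.Nat.Divisibility using (_∣_; divides; m∣m*n; ∣⇒≤; ∣1⇒≡1)
open import Data.Nat.DivMod using (m/n*n≡m; m*n/n≡m; m≡m%n+[m/n]*n; m%n<n)
open import Data.Nat.Primality
  using (Prime; euclidsLemma; prime⇒nonTrivial; prime⇒nonZero; ¬prime[1])
import Data.Nat.Properties as ℕ
import Data.Nat.Tactic.RingSolver as ℕ-RingSolver
open import Data.Product using (∃-syntax; _×_; _,_; proj₁; proj₂)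
open import Data.Sum using (_⊎_; inj₁; inj₂; [_,_]′)
open import Data.Vec.Functional using (tail; init; insertAt; removeAt)
open import Data.Vec.Functional.Properties using (insertAt-lookup; insertAt-punchIn)
open import Function using (_∘_; flip)
import Level
import Relation.Binary.Reasoning.Setoid as SetoidReasoning
open import Relation.Binary.PropositionalEquality as ≡ using (_≡_; _≢_)
open import Relation.Nullary using (¬_; Dec; yes; no; does)
open import Relation.Nullary.Decidable using (dec-true; dec-false)

-- Why columns: `det` expands along the first row, which treats the rows unequally but deletes one
-- column per term, so linearity and alternation in the columns pass up from the minors by
-- induction. Where M comes from: for nonzero x and y the power of the form is the sum of c_k
-- x^(p+1-k) y^k over k from 0 to p + 1, where 2 n = p + 1. The terms k = 1 and k = p both become x
-- y, with total coefficient n + n = p + 1 = 1. The terms k = 0 and k = p + 1 become x^2 y^(p-1) and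
-- x^(p-1) y^2, so they are added to the two ends of the antidiagonal block, symmetrically because
-- c_0 = c_(p+1). Why p > 3: for p = 3 the block is a single entry, both ends coincide with the
-- centre, and that entry is T_2 + 2 instead of T_2. The determinant of V is never evaluated. It is
-- absorbed into w, and w is nonzero because det S is.

-- Neighbouring indices.

data _⋖_ : ∀ {n} → Fin n → Fin n → Set where
  here  : ∀ {n} → zero {suc n} ⋖ suc zero
  there : ∀ {n} {k l : Fin n} → k ⋖ l → suc k ⋖ suc l

⋖⇒toℕ : ∀ {n} {k l : Fin n} → k ⋖ l → toℕ l ≡ suc (toℕ k)
⋖⇒toℕ here      = ≡.refl
⋖⇒toℕ (there a) = ≡.cong suc (⋖⇒toℕ a)

-- Nothing lies between neighbours, so deleting a third index cannot separate them. This carries a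
-- pair of equal neighbouring columns into a minor.
⋖-punchIn : ∀ {n} {k l : Fin (suc n)} → k ⋖ l → ∀ j → j ≢ k → j ≢ l →
            ∃[ k′ ] ∃[ l′ ] (k′ ⋖ l′ × punchIn j k′ ≡ k × punchIn j l′ ≡ l)
⋖-punchIn here zero j≢k _ = ⊥-elim (j≢k ≡.refl)
⋖-punchIn here (suc zero) _ j≢l = ⊥-elim (j≢l ≡.refl)
⋖-punchIn {suc (suc n)} here (suc (suc j)) _ _ = zero , suc zero , here , ≡.refl , ≡.refl
⋖-punchIn (there a) zero _ _ = _ , _ , a , ≡.refl , ≡.refl
⋖-punchIn {suc n} (there a) (suc j) j≢k j≢l
  with k′ , l′ , a′ , eqk , eql ← ⋖-punchIn a j (j≢k ∘ ≡.cong suc) (j≢l ∘ ≡.cong suc)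
  = suc k′ , suc l′ , there a′ , ≡.cong suc eqk , ≡.cong suc eql

-- Deleting either of two neighbours leaves the other in the same place, so the two minors of a
-- matrix whose columns `k` and `l` agree are equal.
punchIn-⋖ : ∀ {n} {k l : Fin (suc n)} → k ⋖ l → ∀ i →
            punchIn k i ≡ punchIn l i ⊎ (punchIn k i ≡ l × punchIn l i ≡ k)
punchIn-⋖ here zero = inj₂ (≡.refl , ≡.refl)
punchIn-⋖ here (suc i) = inj₁ ≡.refl
punchIn-⋖ (there a) zero = inj₁ ≡.refl
punchIn-⋖ (there a) (suc i) with punchIn-⋖ a i
... | inj₁ eq = inj₁ (≡.cong suc eq)
... | inj₂ (eqk , eql) = inj₂ (≡.cong suc eqk , ≡.cong suc eql)

-- Alternating forms and determinants over a commutative ring.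

module Determinants {c ℓ} (R : CommutativeRing c ℓ) where
  open import Data.Vec.Functional using (_∷_)
  open CommutativeRing R hiding (zero)
  open RingProperties ring using (-‿distribˡ-*; -1*x≈-x; -‿involutive; +-inverseˡ-unique)
  open SemiringExp semiring using (_^_)
  open SemiringSum semiring
    using (sum; sum-cong-≋; sum-replicate-zero; ∑-distrib-+; *-distribˡ-sum; *-distribʳ-sum)
  open Determinant R using (det)
  open SetoidReasoning setoid
  open MonoidSum *-commutativeMonoid using ()
    renaming (sum to product; sum-cong-≋ to product-cong; sum-init-last to product-init-last)
  open SemiringSolver commutativeSemiring using (solve; con; _:=_; _:+_; _:*_)

  sum-⋖ : ∀ {n} {k l : Fin n} → k ⋖ l → ∀ (t : Fin n → Carrier) → t k + t l ≈ 0# →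
          (∀ j → j ≢ k → j ≢ l → t j ≈ 0#) → sum t ≈ 0#
  sum-⋖ {suc (suc n)} here t tk+tl≈0 t≈0 = begin
    t zero + (t (suc zero) + sum (tail (tail t))) ≈⟨ +-assoc _ _ _ ⟨
    t zero + t (suc zero) + sum (tail (tail t))
      ≈⟨ +-cong tk+tl≈0 (trans (sum-cong-≋ (λ j → t≈0 (suc (suc j)) (λ ()) (λ ()))) (sum-replicate-zero n)) ⟩
    0# + 0# ≈⟨ +-identityˡ 0# ⟩
    0# ∎
  sum-⋖ (there a) t tk+tl≈0 t≈0 = begin
    t zero + sum (tail t)
      ≈⟨ +-cong (t≈0 zero (λ ()) (λ ()))
                (sum-⋖ a (tail t) tk+tl≈0 λ j j≢k j≢l →
                  t≈0 (suc j) (j≢k ∘ suc-injective) (j≢l ∘ suc-injective)) ⟩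
    0# + 0# ≈⟨ +-identityˡ 0# ⟩
    0# ∎

  -- Families of vectors are compared entrywise, which does not yield propositional equality of
  -- functions; hence `respects`, and three families in `linear` in place of one updated at `k`.
  -- Only neighbours occur in `alternate`: this is what an induction through minors gives, and swaps
  -- of neighbours do the remaining work.
  record Alternating {N n} (f : (Fin n → Fin N → Carrier) → Carrier) : Set (c Level.⊔ ℓ) where
    field
      respects  : ∀ {v w} → (∀ i j → v i j ≈ w i j) → f v ≈ f w
      linear    : ∀ k a {u v w} →
                  (∀ i → i ≢ k → ∀ j → u i j ≈ w i j) →
                  (∀ i → i ≢ k → ∀ j → v i j ≈ w i j) →
                  (∀ j → w k j ≈ a * u k j + v k j) →
                  f w ≈ a * f u + f v
      alternate : ∀ {k l} → k ⋖ l → ∀ {v} → (∀ j → v k j ≈ v l j) → f v ≈ 0#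
  open Alternating

  det-cong : ∀ {n} {A B : Fin n → Fin n → Carrier} →
             (∀ i j → A i j ≈ B i j) → det A ≈ det B
  det-cong {zero}  A≈B = refl
  det-cong {suc n} A≈B = sum-cong-≋ λ j →
    *-cong (*-congˡ {(- 1#) ^ toℕ j} (A≈B zero j)) (det-cong λ i k → A≈B (suc i) (punchIn j k))

  -- In the term that deletes column `j`, a change in column `j` affects only the entry, and a
  -- change in any other column only the minor. If two neighbouring columns agree, the terms that
  -- delete neither vanish by induction, and the other two have equal minors and opposite signs.
  det-alternating : ∀ {n} → Alternating (det ∘ flip {A = Fin n} {B = Fin n})
  det-alternating {n} .respects v≈w = det-cong (flip v≈w)
  det-alternating {suc n} .linear k a {u} {v} {w} u≈w v≈w wk = begin
    sum (term w)                            ≈⟨ sum-cong-≋ term-linear ⟩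
    sum (λ j → a * term u j + term v j)     ≈⟨ ∑-distrib-+ (λ j → a * term u j) (term v) ⟩
    sum (λ j → a * term u j) + sum (term v) ≈⟨ +-congʳ (*-distribˡ-sum a (term u)) ⟨
    a * sum (term u) + sum (term v)         ∎
    where
    minor : (Fin (suc n) → Fin (suc n) → Carrier) → Fin (suc n) → Carrier
    minor x j = det (λ i l → x (punchIn j l) (suc i))
    term : (Fin (suc n) → Fin (suc n) → Carrier) → Fin (suc n) → Carrier
    term x j = (((- 1#) ^ toℕ j) * x j zero) * minor x j

    distribute-entry : ∀ s a p q m → (s * (a * p + q)) * m ≈ a * ((s * p) * m) + (s * q) * m
    distribute-entry = solve 5 (λ s a p q m →
      (s :* (a :* p :+ q)) :* m := (a :* ((s :* p) :* m) :+ (s :* q) :* m)) refl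
    distribute-minor : ∀ s a m m′ → s * (a * m + m′) ≈ a * (s * m) + s * m′
    distribute-minor = solve 4 (λ s a m m′ → s :* (a :* m :+ m′) := (a :* (s :* m) :+ s :* m′)) refl

    term-linear : ∀ j → term w j ≈ a * term u j + term v j
    term-linear j with j ≟ k
    ... | yes ≡.refl = begin
      term w j
        ≈⟨ *-congʳ (*-congˡ (wk zero)) ⟩
      ((((- 1#) ^ toℕ j) * (a * u j zero + v j zero)) * minor w j)
        ≈⟨ distribute-entry _ a _ _ _ ⟩
      a * ((((- 1#) ^ toℕ j) * u j zero) * minor w j) + (((- 1#) ^ toℕ j) * v j zero) * minor w j
        ≈⟨ +-cong (*-congˡ (*-congˡ (det-cong λ i l → sym (u≈w _ (punchInᵢ≢i j l) (suc i)))))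
                  (*-congˡ (det-cong λ i l → sym (v≈w _ (punchInᵢ≢i j l) (suc i)))) ⟩
      a * term u j + term v j ∎
    ... | no j≢k = begin
      term w j
        ≈⟨ *-congˡ (det-alternating .linear (punchOut j≢k) a
             (λ i i≢ → u≈w _ (avoid i i≢) ∘ suc) (λ i i≢ → v≈w _ (avoid i i≢) ∘ suc)
             (λ i → ≡.subst (λ l → w l (suc i) ≈ a * u l (suc i) + v l (suc i))
                      (≡.sym (punchIn-punchOut j≢k)) (wk (suc i)))) ⟩
      (((- 1#) ^ toℕ j) * w j zero) * (a * minor u j + minor v j)
        ≈⟨ distribute-minor _ a _ _ ⟩
      a * ((((- 1#) ^ toℕ j) * w j zero) * minor u j) + (((- 1#) ^ toℕ j) * w j zero) * minor v j
        ≈⟨ +-cong (*-congˡ (*-congʳ (*-congˡ (sym (u≈w j j≢k zero)))))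
                  (*-congʳ (*-congˡ (sym (v≈w j j≢k zero)))) ⟩
      a * term u j + term v j ∎
      where
      avoid : ∀ i → i ≢ punchOut j≢k → punchIn j i ≢ k
      avoid i i≢ eq = i≢ (punchIn-injective j _ _ (≡.trans eq (≡.sym (punchIn-punchOut j≢k))))
  det-alternating {suc n} .alternate {k} {l} k⋖l {v} vk≈vl = sum-⋖ k⋖l _
    (begin
      (((- 1#) ^ toℕ k) * v k zero) * minor k + (((- 1#) ^ toℕ l) * v l zero) * minor l
        ≈⟨ +-congˡ (*-cong (*-cong (reflexive (≡.cong ((- 1#) ^_) (⋖⇒toℕ k⋖l))) (sym (vk≈vl zero)))
                           (sym minor-eq)) ⟩
      (((- 1#) ^ toℕ k) * v k zero) * minor k + ((- 1# * (- 1#) ^ toℕ k) * v k zero) * minor k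
        ≈⟨ +-congˡ (trans (*-congʳ (*-congʳ (-1*x≈-x _))) (pull-neg _ _ _)) ⟩
      (((- 1#) ^ toℕ k) * v k zero) * minor k - (((- 1#) ^ toℕ k) * v k zero) * minor k
        ≈⟨ -‿inverseʳ _ ⟩
      0# ∎)
    (λ j j≢k j≢l → case-other j (⋖-punchIn k⋖l j j≢k j≢l))
    where
    minor : Fin (suc n) → Carrier
    minor j = det (λ i m → v (punchIn j m) (suc i))
    pull-neg : ∀ s x m → ((- s) * x) * m ≈ - ((s * x) * m)
    pull-neg s x m = trans (*-congʳ (sym (-‿distribˡ-* s x))) (sym (-‿distribˡ-* (s * x) m))
    minor-eq : minor k ≈ minor l
    minor-eq = det-cong λ i m → entry i m (punchIn-⋖ k⋖l m)
      where
      entry : ∀ i m → punchIn k m ≡ punchIn l m ⊎ (punchIn k m ≡ l × punchIn l m ≡ k) →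
              v (punchIn k m) (suc i) ≈ v (punchIn l m) (suc i)
      entry i m (inj₁ eq) = reflexive (≡.cong (λ x → v x (suc i)) eq)
      entry i m (inj₂ (eqk , eql)) = begin
        v (punchIn k m) (suc i) ≡⟨ ≡.cong (λ x → v x (suc i)) eqk ⟩
        v l (suc i)             ≈⟨ vk≈vl (suc i) ⟨
        v k (suc i)             ≡⟨ ≡.cong (λ x → v x (suc i)) eql ⟨
        v (punchIn l m) (suc i) ∎
    case-other : ∀ j → ∃[ k′ ] ∃[ l′ ] (k′ ⋖ l′ × punchIn j k′ ≡ k × punchIn j l′ ≡ l) →
                 (((- 1#) ^ toℕ j) * v j zero) * minor j ≈ 0#
    case-other j (k′ , l′ , k′⋖l′ , ≡.refl , ≡.refl) =
      trans (*-congˡ (det-alternating .alternate k′⋖l′ (vk≈vl ∘ suc))) (zeroʳ _)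

  module _ {N n} {f : (Fin (suc n) → Fin N → Carrier) → Carrier} (alt : Alternating f) where

    ∷-alternating : ∀ x → Alternating (f ∘ (x ∷_))
    ∷-alternating x .respects v≈w = alt .respects λ { zero j → refl ; (suc i) → v≈w i }
    ∷-alternating x .linear k a u≈w v≈w = alt .linear (suc k) a
      (λ { zero _ _ → refl ; (suc i) i≢k → u≈w i (i≢k ∘ ≡.cong suc) })
      (λ { zero _ _ → refl ; (suc i) i≢k → v≈w i (i≢k ∘ ≡.cong suc) })
    ∷-alternating x .alternate k⋖l = alt .alternate (there k⋖l)

    head-linear : ∀ a {x y z} w → (∀ j → z j ≈ a * x j + y j) →
                  f (z ∷ w) ≈ a * f (x ∷ w) + f (y ∷ w)
    head-linear a w = alt .linear zero a
      (λ { zero 0≢0 → ⊥-elim (0≢0 ≡.refl) ; (suc i) _ _ → refl })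
      (λ { zero 0≢0 → ⊥-elim (0≢0 ≡.refl) ; (suc i) _ _ → refl })

    head-zero : ∀ w → f ((λ _ → 0#) ∷ w) ≈ 0#
    head-zero w = begin
      -- Zero is written as (-1) 0 + 0, which makes the value equal to its negative plus itself.
      f (0ᵛ ∷ w)                         ≈⟨ head-linear (- 1#) w (λ _ → sym (-1*x+x≈0 0#)) ⟩
      (- 1#) * f (0ᵛ ∷ w) + f (0ᵛ ∷ w)   ≈⟨ -1*x+x≈0 _ ⟩
      0#                                 ∎
      where
      0ᵛ : Fin N → Carrier
      0ᵛ _ = 0#
      -1*x+x≈0 : ∀ x → (- 1#) * x + x ≈ 0#
      -1*x+x≈0 x = trans (+-congʳ (-1*x≈-x x)) (-‿inverseˡ x)

    head-sum : ∀ {m} (a : Fin m → Carrier) (b : Fin m → Fin N → Carrier) w →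
               f ((λ j → sum λ i → a i * b i j) ∷ w) ≈ sum λ i → a i * f (b i ∷ w)
    head-sum {zero}  a b w = head-zero w
    head-sum {suc m} a b w = trans
      (head-linear (a zero) {y = λ j → sum λ i → a (suc i) * b (suc i) j} w (λ _ → refl))
      (+-congˡ (head-sum (tail a) (tail b) w))

    ∷-η : ∀ v → f v ≈ f (v zero ∷ tail v)
    ∷-η v = alt .respects λ { zero j → refl ; (suc i) j → refl }

  module _ {N n} {f : (Fin (suc (suc n)) → Fin N → Carrier) → Carrier} (alt : Alternating f) where

    -- Polarisation: the value at (x + y, x + y) vanishes and expands into four terms, of which
    -- those at (x, x) and (y, y) vanish too.
    swap : ∀ x y w → f (x ∷ y ∷ w) ≈ - f (y ∷ x ∷ w)
    swap x y w = +-inverseˡ-unique _ _ (begin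
      f (x ∷ y ∷ w) + f (y ∷ x ∷ w)
        ≈⟨ +-cong (+-identityˡ _) (+-identityʳ _) ⟨
      (0# + f (x ∷ y ∷ w)) + (f (y ∷ x ∷ w) + 0#)
        ≈⟨ +-cong (+-congʳ (alt .alternate here (λ _ → refl))) (+-congˡ (alt .alternate here (λ _ → refl))) ⟨
      (f (x ∷ x ∷ w) + f (x ∷ y ∷ w)) + (f (y ∷ x ∷ w) + f (y ∷ y ∷ w))
        ≈⟨ solve 4 (λ a b c d → con 1 :* (con 1 :* a :+ b) :+ (con 1 :* c :+ d)
                              := (a :+ b) :+ (c :+ d)) refl _ _ _ _ ⟨
      1# * (1# * f (x ∷ x ∷ w) + f (x ∷ y ∷ w)) + (1# * f (y ∷ x ∷ w) + f (y ∷ y ∷ w))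
        ≈⟨ +-cong (*-congˡ (second x)) (second y) ⟨
      1# * f (x ∷ x+y ∷ w) + f (y ∷ x+y ∷ w)
        ≈⟨ head-linear alt 1# (x+y ∷ w) split ⟨
      f (x+y ∷ x+y ∷ w)
        ≈⟨ alt .alternate here (λ _ → refl) ⟩
      0# ∎)
      where
      x+y : Fin N → Carrier
      x+y j = x j + y j
      split : ∀ j → x+y j ≈ 1# * x j + y j
      split j = +-congʳ (sym (*-identityˡ (x j)))
      second : ∀ z → f (z ∷ x+y ∷ w) ≈ 1# * f (z ∷ x ∷ w) + f (z ∷ y ∷ w)
      second z = head-linear (∷-alternating alt z) 1# w split

  -- Only the neighbour of `x` can be cleared directly. One swap then moves `x` past it, the
  -- recursion clears the rest, and a second swap moves `x` back and cancels the sign.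
  add-multiples : ∀ {N n} {f : (Fin (suc n) → Fin N → Carrier) → Carrier} → Alternating f →
                  ∀ x (a : Fin n → Carrier) {v w} → (∀ i j → w i j ≈ a i * x j + v i j) →
                  f (x ∷ w) ≈ f (x ∷ v)
  add-multiples {n = zero}  alt x a w≈ = alt .respects λ { zero j → refl ; (suc ()) }
  add-multiples {n = suc n} {f} alt x a {v} {w} w≈ = begin
    f (x ∷ w)
      ≈⟨ ∷-η (∷-alternating alt x) w ⟩
    f (x ∷ w zero ∷ tail w)
      ≈⟨ head-linear (∷-alternating alt x) (a zero) (tail w) (w≈ zero) ⟩
    a zero * f (x ∷ x ∷ tail w) + f (x ∷ v zero ∷ tail w)
      ≈⟨ +-cong (trans (*-congˡ (alt .alternate here (λ _ → refl))) (zeroʳ _)) (swap alt x (v zero) (tail w)) ⟩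
    0# - f (v zero ∷ x ∷ tail w)
      ≈⟨ +-identityˡ _ ⟩
    - f (v zero ∷ x ∷ tail w)
      ≈⟨ -‿cong (add-multiples (∷-alternating alt (v zero)) x (tail a) (λ i → w≈ (suc i))) ⟩
    - f (v zero ∷ x ∷ tail v)
      ≈⟨ swap alt x (v zero) (tail v) ⟨
    f (x ∷ v zero ∷ tail v)
      ≈⟨ ∷-η (∷-alternating alt x) v ⟨
    f (x ∷ v) ∎

  insertAt-sign : ∀ {N n} {f : (Fin (suc n) → Fin N → Carrier) → Carrier} → Alternating f →
                  ∀ j x w → f (x ∷ w) ≈ (- 1#) ^ toℕ j * f (insertAt w j x)
  insertAt-sign alt zero x w =
    trans (alt .respects λ { zero j → refl ; (suc i) j → refl }) (sym (*-identityˡ _))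
  insertAt-sign {n = suc n} {f} alt (suc j) x w = begin
    f (x ∷ w)                                         ≈⟨ ∷-η (∷-alternating alt x) w ⟩
    f (x ∷ w zero ∷ tail w)                           ≈⟨ swap alt x (w zero) (tail w) ⟩
    - f (w zero ∷ x ∷ tail w)
      ≈⟨ -‿cong (insertAt-sign (∷-alternating alt (w zero)) j x (tail w)) ⟩
    - (s * f (w zero ∷ insertAt (tail w) j x))        ≈⟨ -1*x≈-x _ ⟨
    (- 1#) * (s * f (w zero ∷ insertAt (tail w) j x)) ≈⟨ *-assoc (- 1#) s _ ⟨
    ((- 1#) * s) * f (w zero ∷ insertAt (tail w) j x)
      ≈⟨ *-congˡ (alt .respects λ { zero j → refl ; (suc i) j → refl }) ⟩
    ((- 1#) * s) * f (insertAt w (suc j) x)           ∎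
    where
    s = (- 1#) ^ toℕ j

  -- The identity matrix, by recursion instead of by decidable equality, so that the minor at the
  -- corner is again `δ` by computation.
  δ : ∀ {n} → Fin n → Fin n → Carrier
  δ zero    zero    = 1#
  δ zero    (suc j) = 0#
  δ (suc i) zero    = 0#
  δ (suc i) (suc j) = δ i j

  δ-refl : ∀ {n} (i : Fin n) → δ i i ≡ 1#
  δ-refl zero    = ≡.refl
  δ-refl (suc i) = δ-refl i

  δ-sym : ∀ {n} (i j : Fin n) → δ i j ≡ δ j i
  δ-sym zero    zero    = ≡.refl
  δ-sym zero    (suc j) = ≡.refl
  δ-sym (suc i) zero    = ≡.refl
  δ-sym (suc i) (suc j) = δ-sym i j

  δ-≢ : ∀ {n} {i j : Fin n} → i ≢ j → δ i j ≡ 0#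
  δ-≢ {i = zero}  {zero}  i≢j = ⊥-elim (i≢j ≡.refl)
  δ-≢ {i = zero}  {suc j} i≢j = ≡.refl
  δ-≢ {i = suc i} {zero}  i≢j = ≡.refl
  δ-≢ {i = suc i} {suc j} i≢j = δ-≢ (i≢j ∘ ≡.cong suc)

  δ-punchIn : ∀ {n} (k : Fin (suc n)) i j → δ (punchIn k i) (punchIn k j) ≡ δ i j
  δ-punchIn zero    i       j       = ≡.refl
  δ-punchIn (suc k) zero    zero    = ≡.refl
  δ-punchIn (suc k) zero    (suc j) = ≡.refl
  δ-punchIn (suc k) (suc i) zero    = ≡.refl
  δ-punchIn (suc k) (suc i) (suc j) = δ-punchIn k i j

  sum-zeroʳ : ∀ {n} (t : Fin n → Carrier) → (sum λ i → t i * 0#) ≈ 0#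
  sum-zeroʳ {n} t = trans (sum-cong-≋ (zeroʳ ∘ t)) (sum-replicate-zero n)

  sum-δ : ∀ {n} (t : Fin n → Carrier) j → (sum λ i → t i * δ i j) ≈ t j
  sum-δ t zero = trans (+-cong (*-identityʳ _) (sum-zeroʳ (tail t))) (+-identityʳ _)
  sum-δ t (suc j) = trans (+-cong (zeroʳ _) (sum-δ (tail t) j)) (+-identityˡ _)

  data PunchView {n} (i : Fin (suc n)) : Fin (suc n) → Set where
    same  : PunchView i i
    other : ∀ j → PunchView i (punchIn i j)

  punchView : ∀ {n} (i j : Fin (suc n)) → PunchView i j
  punchView i j with i ≟ j
  ... | yes ≡.refl = same
  ... | no i≢j     = ≡.subst (PunchView i) (punchIn-punchOut i≢j) (other (punchOut i≢j))

  insertAt-δ : ∀ {n} (i : Fin (suc n)) s j →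
               insertAt (λ r → insertAt (δ r) i 0#) i (δ i) s j ≡ δ s j
  insertAt-δ i s j with punchView i s
  ... | same = ≡.cong (λ x → x j) (insertAt-lookup _ i (δ i))
  ... | other r with punchView i j
  ...   | same = ≡.trans (≡.cong (λ x → x j) (insertAt-punchIn _ i (δ i) r))
                   (≡.trans (insertAt-lookup (δ r) i 0#) (≡.sym (δ-≢ (punchInᵢ≢i i r))))
  ...   | other c = ≡.trans (≡.cong (λ x → x j) (insertAt-punchIn _ i (δ i) r))
                      (≡.trans (insertAt-punchIn (δ r) i 0# c) (≡.sym (δ-punchIn i r c)))

  split-coordinate : ∀ {n} (i : Fin (suc n)) (x : Fin (suc n) → Carrier) j →
                     x j ≈ x i * δ i j + insertAt (removeAt x i) i 0# j
  split-coordinate i x j with punchView i j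
  ... | same = begin
    x i               ≈⟨ trans (+-identityʳ _) (*-identityʳ _) ⟨
    x i * 1# + 0#     ≡⟨ ≡.cong₂ (λ a b → x i * a + b) (δ-refl i) (insertAt-lookup (removeAt x i) i 0#) ⟨
    x i * δ i i + insertAt (removeAt x i) i 0# i ∎
  ... | other k = begin
    x (punchIn i k)   ≈⟨ trans (+-congʳ (zeroʳ _)) (+-identityˡ _) ⟨
    x i * 0# + x (punchIn i k)
      ≡⟨ ≡.cong₂ (λ a b → x i * a + b) (δ-≢ (punchInᵢ≢i i k ∘ ≡.sym)) (insertAt-punchIn (removeAt x i) i 0# k) ⟨
    x i * δ i (punchIn i k) + insertAt (removeAt x i) i 0# (punchIn i k) ∎

  -- Applied to two linear maps: insertion of a zero coordinate, which lowers the dimension in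
  -- `alternating-unique`, and multiplication by a matrix in `det-⊛`.
  ∘-alternating : ∀ {M N n} {f : (Fin n → Fin N → Carrier) → Carrier} → Alternating f →
                  (L : (Fin M → Carrier) → Fin N → Carrier) →
                  (∀ {x y} → (∀ j → x j ≈ y j) → ∀ i → L x i ≈ L y i) →
                  (∀ a {x y z} → (∀ j → z j ≈ a * x j + y j) → ∀ i → L z i ≈ a * L x i + L y i) →
                  Alternating (f ∘ (L ∘_))
  ∘-alternating alt L L-cong L-linear .respects v≈w = alt .respects λ i → L-cong (v≈w i)
  ∘-alternating alt L L-cong L-linear .linear k a u≈w v≈w wk = alt .linear k a
    (λ i i≢k → L-cong (u≈w i i≢k)) (λ i i≢k → L-cong (v≈w i i≢k)) (L-linear a wk)
  ∘-alternating alt L L-cong L-linear .alternate k⋖l vk≈vl = alt .alternate k⋖l (L-cong vk≈vl)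

  insertAt-cong : ∀ {n} (i : Fin (suc n)) {x y : Fin n → Carrier} →
                  (∀ j → x j ≈ y j) → ∀ j → insertAt x i 0# j ≈ insertAt y i 0# j
  insertAt-cong i {x} {y} x≈y j with punchView i j
  ... | same    = reflexive (≡.trans (insertAt-lookup x i 0#) (≡.sym (insertAt-lookup y i 0#)))
  ... | other k = trans (reflexive (insertAt-punchIn x i 0# k))
                    (trans (x≈y k) (reflexive (≡.sym (insertAt-punchIn y i 0# k))))

  insertAt-linear : ∀ {n} (i : Fin (suc n)) a {x y z : Fin n → Carrier} →
                    (∀ j → z j ≈ a * x j + y j) →
                    ∀ j → insertAt z i 0# j ≈ a * insertAt x i 0# j + insertAt y i 0# j
  insertAt-linear i a {x} {y} {z} z≈ j with punchView i j
  ... | same = begin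
    insertAt z i 0# i   ≡⟨ insertAt-lookup z i 0# ⟩
    0#                  ≈⟨ trans (+-identityʳ _) (zeroʳ a) ⟨
    a * 0# + 0#         ≡⟨ ≡.cong₂ (λ b c → a * b + c) (insertAt-lookup x i 0#) (insertAt-lookup y i 0#) ⟨
    a * insertAt x i 0# i + insertAt y i 0# i ∎
  ... | other k = begin
    insertAt z i 0# (punchIn i k) ≡⟨ insertAt-punchIn z i 0# k ⟩
    z k                           ≈⟨ z≈ k ⟩
    a * x k + y k
      ≡⟨ ≡.cong₂ (λ b c → a * b + c) (insertAt-punchIn x i 0# k) (insertAt-punchIn y i 0# k) ⟨
    a * insertAt x i 0# (punchIn i k) + insertAt y i 0# (punchIn i k) ∎

  -- Expand the first vector in the basis, clear the i-th coordinate of the others by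
  -- adding multiples of δ i, and recurse on what is then an (n - 1)-dimensional form.
  alternating-unique : ∀ {n} {f : (Fin n → Fin n → Carrier) → Carrier} → Alternating f →
                       ∀ v → f v ≈ det v * f δ
  alternating-unique {zero} alt v = trans (alt .respects λ ()) (sym (*-identityˡ _))
  alternating-unique {suc n} {f} alt v = begin
    f v
      ≈⟨ alt .respects (λ { zero j → sym (sum-δ (v zero) j) ; (suc i) j → refl }) ⟩
    f ((λ j → sum λ i → v zero i * δ i j) ∷ tail v)
      ≈⟨ head-sum alt (v zero) δ (tail v) ⟩
    (sum λ i → v zero i * f (δ i ∷ tail v))
      ≈⟨ sum-cong-≋ (λ i → trans (*-congˡ (expand i)) (rearrange (v zero i) (minor i) ((- 1#) ^ toℕ i) (f δ))) ⟩
    (sum λ i → (((- 1#) ^ toℕ i * v zero i) * minor i) * f δ)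
      ≈⟨ *-distribʳ-sum (f δ) (λ i → ((- 1#) ^ toℕ i * v zero i) * minor i) ⟨
    det v * f δ ∎
    where
    minor : Fin (suc n) → Carrier
    minor i = det (λ r k → v (suc r) (punchIn i k))
    rearrange : ∀ x m s d → x * (m * (s * d)) ≈ ((s * x) * m) * d
    rearrange = solve 4 (λ x m s d → x :* (m :* (s :* d)) := ((s :* x) :* m) :* d) refl
    pad : Fin (suc n) → (Fin n → Carrier) → Fin (suc n) → Carrier
    pad i x = insertAt x i 0#
    expand : ∀ i → f (δ i ∷ tail v) ≈ minor i * ((- 1#) ^ toℕ i * f δ)
    expand i = begin
      f (δ i ∷ tail v)
        ≈⟨ add-multiples alt (δ i) (λ r → v (suc r) i) (λ r → split-coordinate i (v (suc r))) ⟩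
      f (δ i ∷ λ r → pad i (removeAt (v (suc r)) i))
        ≈⟨ alternating-unique
             (∘-alternating (∷-alternating alt (δ i)) (pad i) (insertAt-cong i) (insertAt-linear i))
             (λ r → removeAt (v (suc r)) i) ⟩
      minor i * f (δ i ∷ λ r → pad i (δ r))
        ≈⟨ *-congˡ (insertAt-sign alt i (δ i) _) ⟩
      minor i * ((- 1#) ^ toℕ i * f (insertAt (λ r → pad i (δ r)) i (δ i)))
        ≈⟨ *-congˡ (*-congˡ (alt .respects λ s j → reflexive (insertAt-δ i s j))) ⟩
      minor i * ((- 1#) ^ toℕ i * f δ) ∎

  det-bordered : ∀ {n} (A : Fin (suc n) → Fin (suc n) → Carrier) →
                 (∀ j → A zero (suc j) ≈ 0#) → det A ≈ A zero zero * det (λ i j → A (suc i) (suc j))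
  det-bordered {n} A A₀≈0 = begin
    term zero + sum (tail term)                           ≈⟨ +-cong (*-congʳ (*-identityˡ _)) rest ⟩
    A zero zero * det (λ i j → A (suc i) (suc j)) + 0#    ≈⟨ +-identityʳ _ ⟩
    A zero zero * det (λ i j → A (suc i) (suc j))         ∎
    where
    term : Fin (suc n) → Carrier
    term j = ((- 1#) ^ toℕ j * A zero j) * det (λ i k → A (suc i) (punchIn j k))
    rest : sum (tail term) ≈ 0#
    rest = trans
      (sum-cong-≋ {n} λ j → trans
        (*-congʳ (trans (*-congˡ {(- 1#) ^ suc (toℕ j)} (A₀≈0 j)) (zeroʳ _))) (zeroˡ _))
      (sum-replicate-zero n)

  det-δ : ∀ n → det (δ {n}) ≈ 1#
  det-δ zero    = refl
  det-δ (suc n) = trans (det-bordered (δ {suc n}) (λ _ → refl)) (trans (*-identityˡ _) (det-δ n))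

  -- `det ∘ flip` is alternating in the vectors that `alternating-unique` feeds to `det` as rows, so
  -- uniqueness itself compares the two and only their values at `δ` are left.
  det-transpose : ∀ {n} (A : Fin n → Fin n → Carrier) → det (flip A) ≈ det A
  det-transpose {n} A = begin
    det (flip A)               ≈⟨ alternating-unique det-alternating A ⟩
    det A * det (flip (δ {n})) ≈⟨ *-congˡ (trans (det-cong {n} λ i j → reflexive (δ-sym j i)) (det-δ n)) ⟩
    det A * 1#                 ≈⟨ *-identityʳ _ ⟩
    det A                      ∎

  infixl 7 _⊛_
  _⊛_ : ∀ {m n o} → (Fin m → Fin n → Carrier) → (Fin n → Fin o → Carrier) → Fin m → Fin o → Carrier
  (A ⊛ B) i j = sum λ k → A i k * B k j

  -- The columns of the product are the images of the columns of `B` under `A`, so its determinant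
  -- is an alternating form in the columns of `B`, with value `det A` at the identity.
  det-⊛ : ∀ {n} (A B : Fin n → Fin n → Carrier) → det (A ⊛ B) ≈ det A * det B
  det-⊛ {n} A B = begin
    det (A ⊛ B)
      ≈⟨ alternating-unique (∘-alternating det-alternating L L-cong L-linear) (flip B) ⟩
    det (flip B) * det (λ i j → L (δ j) i)
      ≈⟨ *-cong (det-transpose B) (det-cong λ i j →
           trans (sum-cong-≋ λ k → *-congˡ (reflexive (δ-sym j k))) (sum-δ (A i) j)) ⟩
    det B * det A
      ≈⟨ *-comm _ _ ⟩
    det A * det B ∎
    where
    L : (Fin n → Carrier) → Fin n → Carrier
    L x i = sum λ k → A i k * x k
    L-cong : ∀ {x y} → (∀ j → x j ≈ y j) → ∀ i → L x i ≈ L y i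
    L-cong x≈y i = sum-cong-≋ λ k → *-congˡ (x≈y k)
    L-linear : ∀ a {x y z} → (∀ j → z j ≈ a * x j + y j) → ∀ i → L z i ≈ a * L x i + L y i
    L-linear a {x} {y} {z} z≈ i = begin
      (sum λ k → A i k * z k)
        ≈⟨ sum-cong-≋ (λ k → trans (*-congˡ (z≈ k)) (distribute (A i k) a (x k) (y k))) ⟩
      (sum λ k → a * (A i k * x k) + A i k * y k)
        ≈⟨ ∑-distrib-+ (λ k → a * (A i k * x k)) _ ⟩
      (sum λ k → a * (A i k * x k)) + L y i
        ≈⟨ +-congʳ (*-distribˡ-sum a (λ k → A i k * x k)) ⟨
      a * L x i + L y i ∎
      where
      distribute : ∀ b a x y → b * (a * x + y) ≈ a * (b * x) + b * y
      distribute = solve 4 (λ b a x y → b :* (a :* x :+ y) := a :* (b :* x) :+ b :* y) refl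

  det-congruence : ∀ {n} (V M : Fin n → Fin n → Carrier) {A : Fin n → Fin n → Carrier} →
                   (∀ i j → A i j ≈ ((V ⊛ M) ⊛ flip V) i j) → det A ≈ det V * det M * det V
  det-congruence V M A≈VMVᵀ = trans (det-cong A≈VMVᵀ)
    (trans (det-⊛ (V ⊛ M) (flip V)) (*-cong (det-⊛ V M) (det-transpose V)))

  δ-inject₁ : ∀ {n} (i j : Fin n) → δ (inject₁ i) (inject₁ j) ≡ δ i j
  δ-inject₁ zero    zero    = ≡.refl
  δ-inject₁ zero    (suc j) = ≡.refl
  δ-inject₁ (suc i) zero    = ≡.refl
  δ-inject₁ (suc i) (suc j) = δ-inject₁ i j

  punchIn-fromℕ : ∀ {n} (i : Fin n) → punchIn (fromℕ n) i ≡ inject₁ i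
  punchIn-fromℕ zero    = ≡.refl
  punchIn-fromℕ (suc i) = ≡.cong suc (punchIn-fromℕ i)

  antidiagonal : ∀ {n} → (Fin n → Carrier) → Fin n → Fin n → Carrier
  antidiagonal α i j = δ (opposite i) j * α j

  -- The sign (-1)^(n (n - 1) / 2) of the permutation that reverses n positions.
  reversalSign : ℕ → Carrier
  reversalSign zero    = 1#
  reversalSign (suc n) = (- 1#) ^ n * reversalSign n

  -- The first row has a single entry, in the last column, and the minor there is antidiagonal with
  -- the last weight dropped.
  det-antidiagonal : ∀ {n} (α : Fin n → Carrier) →
                     det (antidiagonal α) ≈ reversalSign n * product α
  det-antidiagonal {zero}  α = sym (*-identityˡ 1#)
  det-antidiagonal {suc n} α = begin
    (sum λ j → ((- 1#) ^ toℕ j * (δ last j * α j)) * minor j)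
      ≈⟨ sum-cong-≋ {suc n} (λ j → trans (*-congʳ (*-congˡ {(- 1#) ^ toℕ j} (*-congʳ (reflexive (δ-sym last j)))))
           (rearrange ((- 1#) ^ toℕ j) (δ j last) (α j) (minor j))) ⟩
    (sum λ j → (((- 1#) ^ toℕ j * α j) * minor j) * δ j last)
      ≈⟨ sum-δ (λ j → ((- 1#) ^ toℕ j * α j) * minor j) last ⟩
    ((- 1#) ^ toℕ last * α last) * minor last
      ≈⟨ *-cong (*-congʳ (reflexive (≡.cong ((- 1#) ^_) (toℕ-fromℕ n)))) minor-last ⟩
    ((- 1#) ^ n * α last) * (reversalSign n * product (α ∘ inject₁))
      ≈⟨ solve 4 (λ s a r q → (s :* a) :* (r :* q) := (s :* r) :* (q :* a)) refl _ _ _ _ ⟩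
    ((- 1#) ^ n * reversalSign n) * (product (α ∘ inject₁) * α last)
      ≈⟨ *-congˡ (product-init-last α) ⟨
    ((- 1#) ^ n * reversalSign n) * product α ∎
    where
    last : Fin (suc n)
    last = fromℕ n
    minor : Fin (suc n) → Carrier
    minor j = det (λ i k → antidiagonal α (suc i) (punchIn j k))
    rearrange : ∀ s d a m → (s * (d * a)) * m ≈ ((s * a) * m) * d
    rearrange = solve 4 (λ s d a m → (s :* (d :* a)) :* m := ((s :* a) :* m) :* d) refl
    minor-last : minor last ≈ reversalSign n * product (α ∘ inject₁)
    minor-last = trans
      (det-cong λ i k → reflexive (≡.trans
        (≡.cong (λ l → δ (inject₁ (opposite i)) l * α l) (punchIn-fromℕ k))
        (≡.cong (_* α (inject₁ k)) (δ-inject₁ (opposite i) k))))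
      (det-antidiagonal (α ∘ inject₁))

  -1^[h+h]≈1 : ∀ h → (- 1#) ^ (h ℕ.+ h) ≈ 1#
  -1^[h+h]≈1 zero = refl
  -1^[h+h]≈1 (suc h) = begin
    - 1# * (- 1#) ^ (h ℕ.+ suc h)       ≡⟨ ≡.cong (λ k → - 1# * (- 1#) ^ k) (ℕ.+-suc h h) ⟩
    - 1# * (- 1# * (- 1#) ^ (h ℕ.+ h))  ≈⟨ trans (-1*x≈-x _) (-‿cong (-1*x≈-x _)) ⟩
    - - ((- 1#) ^ (h ℕ.+ h))            ≈⟨ -‿involutive _ ⟩
    (- 1#) ^ (h ℕ.+ h)                  ≈⟨ -1^[h+h]≈1 h ⟩
    1#                                  ∎

  -- The exponent is h (2 h + 1), which has the parity of h.
  reversalSign-odd : ∀ h → reversalSign (suc (h ℕ.+ h)) ≈ (- 1#) ^ h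
  reversalSign-odd zero = *-identityˡ 1#
  reversalSign-odd (suc h) rewrite ℕ.+-suc h h = begin
    (- 1# * (- 1# * s)) * ((- 1# * s) * reversalSign (suc (h ℕ.+ h)))
      ≈⟨ *-cong (trans (trans (-1*x≈-x _) (-‿cong (-1*x≈-x _))) (-‿involutive s))
                (*-congˡ {(- 1#) * s} (reversalSign-odd h)) ⟩
    s * ((- 1# * s) * (- 1#) ^ h)
      ≈⟨ solve 3 (λ s m r → s :* ((m :* s) :* r) := (s :* s) :* (m :* r)) refl s (- 1#) ((- 1#) ^ h) ⟩
    (s * s) * (- 1# * (- 1#) ^ h)
      ≈⟨ *-congʳ (trans (*-cong (-1^[h+h]≈1 h) (-1^[h+h]≈1 h)) (*-identityˡ 1#)) ⟩
    1# * (- 1# * (- 1#) ^ h)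
      ≈⟨ *-identityˡ _ ⟩
    - 1# * (- 1#) ^ h ∎
    where
    s : Carrier
    s = (- 1#) ^ (h ℕ.+ h)

  -- The outermost two values are equal and multiply to a square; stripping such pairs leaves the
  -- centre alone.
  product-palindrome : ∀ h (β : ℕ → Carrier) → (∀ i j → i ℕ.+ j ≡ h ℕ.+ h → β i ≈ β j) →
                       ∃[ w ] product {suc (h ℕ.+ h)} (β ∘ toℕ) ≈ (w * w) * β h
  product-palindrome zero β pal = 1# , trans (*-comm _ _) (*-congʳ (sym (*-identityˡ 1#)))
  product-palindrome (suc h) β pal rewrite ℕ.+-suc h h
    with w , eq ← product-palindrome h (β ∘ suc)
                    (λ i j i+j≡h+h → pal (suc i) (suc j)
                      (≡.cong suc (≡.trans (ℕ.+-suc i j) (≡.cong suc i+j≡h+h))))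
    = w * β 0 , (begin
    β 0 * product (λ (i : Fin (suc (suc (h ℕ.+ h)))) → β (suc (toℕ i)))
      ≈⟨ *-congˡ (product-init-last (λ (i : Fin (suc (suc (h ℕ.+ h)))) → β (suc (toℕ i)))) ⟩
    β 0 * (product (λ (i : Fin (suc (h ℕ.+ h))) → β (suc (toℕ (inject₁ i))))
            * β (suc (toℕ (fromℕ (suc (h ℕ.+ h))))))
      ≈⟨ *-congˡ (*-cong (product-cong {suc (h ℕ.+ h)} λ i → reflexive (≡.cong (β ∘ suc) (toℕ-inject₁ i)))
                         (reflexive (≡.cong (β ∘ suc) (toℕ-fromℕ (suc (h ℕ.+ h)))))) ⟩
    β 0 * (product (λ (i : Fin (suc (h ℕ.+ h))) → β (suc (toℕ i))) * β (suc (suc (h ℕ.+ h))))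
      ≈⟨ *-congˡ (*-cong eq (sym (pal 0 (suc (suc (h ℕ.+ h))) ≡.refl))) ⟩
    β 0 * (((w * w) * β (suc h)) * β 0)
      ≈⟨ solve 3 (λ b w c → b :* (((w :* w) :* c) :* b) := ((w :* b) :* (w :* b)) :* c) refl _ _ _ ⟩
    ((w * β 0) * (w * β 0)) * β (suc h) ∎)

-- Divisibility of binomial coefficients by a prime.

prime∤! : ∀ {p} → Prime p → ∀ {k} → k < p → ¬ (p ∣ k !)
prime∤! p-prime {zero} k<p p∣1 = ¬prime[1] (≡.subst Prime (∣1⇒≡1 p∣1) p-prime)
prime∤! p-prime {suc k} k<p p∣k! with euclidsLemma (suc k) (k !) p-prime p∣k!
... | inj₁ p∣1+k = ℕ.<⇒≱ k<p (∣⇒≤ p∣1+k)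
... | inj₂ p∣k!′ = prime∤! p-prime (ℕ.<-trans (ℕ.n<1+n k) k<p) p∣k!′

-- The prime divides p!, which is the binomial coefficient times k! (p - k)!, but it divides neither
-- factorial since all their factors are below p.
prime∣C : ∀ {p} → Prime p → ∀ {k} → 0 < k → k < p → p ∣ p C k
prime∣C {suc r} p-prime {k} 0<k k<p
  with euclidsLemma (p C k) (k ! ℕ.* (p ∸ k) !) p-prime (≡.subst (p ∣_) (≡.sym C*d≡p!) (m∣m*n (r !)))
  where
  p = suc r
  instance _ = k ℕ.!* (p ∸ k) !≢0
  C*d≡p! : (p C k) ℕ.* (k ! ℕ.* (p ∸ k) !) ≡ p !
  C*d≡p! = ≡.trans (≡.cong (ℕ._* (k ! ℕ.* (p ∸ k) !)) (nCk≡n!/k![n-k]! (ℕ.<⇒≤ k<p)))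
                   (m/n*n≡m (k![n∸k]!∣n! (ℕ.<⇒≤ k<p)))
... | inj₁ p∣C = p∣C
... | inj₂ p∣d with euclidsLemma (k !) ((suc r ∸ k) !) p-prime p∣d
...   | inj₁ p∣k! = ⊥-elim (prime∤! p-prime k<p p∣k!)
...   | inj₂ p∣! = ⊥-elim (prime∤! p-prime (ℕ.∸-monoʳ-< 0<k (ℕ.<⇒≤ k<p)) p∣!)

-- Congruence modulo p as divisibility.

module ModularRing (p : ℕ) where
  open CommutativeRing (𝔽 p) public hiding (zero)
  open SemiringExp semiring public using (_^_; ^-congˡ; ^-homo-*; ^-assocʳ)
  open CommutativeSemiringExp commutativeSemiring public using (^-distrib-*)

  ∣⇒≈0 : ∀ {x} → + p ℤ∣.∣ x → x ≈ 0ℤ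
  ∣⇒≈0 {x} d = congruent (≡.subst (+ p ℤ∣.∣_) (≡.sym (ℤ.+-identityʳ x)) d)

  ≈0⇒∣ : ∀ {x} → x ≈ 0ℤ → + p ℤ∣.∣ x
  ≈0⇒∣ {x} (congruent d) = ≡.subst (+ p ℤ∣.∣_) (ℤ.+-identityʳ x) d

  ≈⇒-≈0 : ∀ {x y} → x ≈ y → x ℤ.- y ≈ 0ℤ
  ≈⇒-≈0 (congruent d) = ∣⇒≈0 d

  -≈0⇒≈ : ∀ {x y} → x ℤ.- y ≈ 0ℤ → x ≈ y
  -≈0⇒≈ e = congruent (≈0⇒∣ e)

  p≈0 : + p ≈ 0ℤ
  p≈0 = ∣⇒≈0 (ℤ∣.divides 1ℤ (≡.sym (ℤ.*-identityˡ (+ p))))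

  0<+<p⇒≉0 : ∀ {n} → 0 < n → n < p → ¬ (+ n ≈ 0ℤ)
  0<+<p⇒≉0 {suc n} _ n<p n≈0 = ℕ.<⇒≱ n<p (∣⇒≤ (ℤ∣.∣⇒∣ᵤ (≈0⇒∣ n≈0)))

-- The prime field: Fermat's theorem, roots of polynomials, Euler's criterion.

module PrimeField {p : ℕ} (p-prime : Prime p) where
  open import Data.Vec using (Vec; []; _∷_; replicate)
  open ModularRing p public
  open SetoidReasoning setoid

  private instance
    p≢0 : ℕ.NonZero p
    p≢0 = prime⇒nonZero p-prime

  x*y≈0⇒x≈0⊎y≈0 : ∀ x y → x * y ≈ 0ℤ → x ≈ 0ℤ ⊎ y ≈ 0ℤ
  x*y≈0⇒x≈0⊎y≈0 x y xy≈0
    with euclidsLemma ∣ x ∣ ∣ y ∣ p-prime (≡.subst (p ∣_) (ℤ.abs-* x y) (ℤ∣.∣⇒∣ᵤ (≈0⇒∣ xy≈0)))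
  ... | inj₁ p∣x = inj₁ (∣⇒≈0 (ℤ∣.∣ᵤ⇒∣ p∣x))
  ... | inj₂ p∣y = inj₂ (∣⇒≈0 (ℤ∣.∣ᵤ⇒∣ p∣y))

  *-cancelˡ-≉0 : ∀ {x} → ¬ (x ≈ 0ℤ) → ∀ {y z} → x * y ≈ x * z → y ≈ z
  *-cancelˡ-≉0 {x} x≉0 {y} {z} xy≈xz =
    [ ⊥-elim ∘ x≉0 , -≈0⇒≈ ]′ (x*y≈0⇒x≈0⊎y≈0 x (y ℤ.- z)
      (trans (reflexive (distribute x y z)) (≈⇒-≈0 xy≈xz)))
    where
    distribute : ∀ x y z → x ℤ.* (y ℤ.- z) ≡ x ℤ.* y ℤ.- x ℤ.* z
    distribute = solve-∀

  private
    open SemiringSum semiring using (sum; sum-cong-≋; sum-init-last; sum-replicate-zero)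
    open SemiringMult semiring using (×-homo-1) renaming (_×_ to _⋆_)

    ⋆≡* : ∀ n x → n ⋆ x ≡ + n ℤ.* x
    ⋆≡* zero    x = ≡.refl
    ⋆≡* (suc n) x = ≡.trans (≡.cong (λ y → x ℤ.+ y) (⋆≡* n x)) (≡.sym (ℤ.suc-* (+ n) x))

    ∣⇒⋆≈0 : ∀ {n} → p ∣ n → ∀ x → n ⋆ x ≈ 0ℤ
    ∣⇒⋆≈0 {n} p∣n x = begin
      n ⋆ x       ≡⟨ ⋆≡* n x ⟩
      + n ℤ.* x   ≈⟨ *-congʳ {x} {+ n} {0ℤ} (∣⇒≈0 (ℤ∣.∣ᵤ⇒∣ p∣n)) ⟩
      0ℤ ℤ.* x    ≡⟨ ℤ.*-zeroˡ x ⟩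
      0ℤ          ∎

  1^n≈1 : ∀ n → 1ℤ ^ n ≈ 1ℤ
  1^n≈1 zero    = refl
  1^n≈1 (suc n) = trans (*-identityˡ _) (1^n≈1 n)

  0^n≈0 : ∀ n → .{{ℕ.NonZero n}} → 0ℤ ^ n ≈ 0ℤ
  0^n≈0 (suc n) = zeroˡ (0ℤ ^ n)

  -- The inner binomial coefficients vanish modulo p. In `helper` the exponent is a separate
  -- variable, so that it can be matched as `suc r` while the modulus remains `p`.
  frobenius : ∀ x → (1ℤ + x) ^ p ≈ 1ℤ + x ^ p
  frobenius x = helper p ≡.refl
    where
    module Bin = Binomial commutativeSemiring
    helper : ∀ n → n ≡ p → (1ℤ + x) ^ n ≈ 1ℤ + x ^ n
    helper zero 0≡p = ⊥-elim (ℕ.≢-nonZero⁻¹ p (≡.sym 0≡p))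
    helper (suc r) 1+r≡p = begin
      (1ℤ + x) ^ suc r
        ≈⟨ ^-congˡ (suc r) (+-comm 1ℤ x) ⟩
      (x + 1ℤ) ^ suc r
        ≈⟨ Bin.theorem (suc r) x 1ℤ ⟩
      t zero + sum (tail t)
        ≈⟨ +-cong head≈ (trans (sum-init-last (tail t)) (+-cong middle≈ last≈)) ⟩
      1ℤ + (0ℤ + x ^ suc r)
        ≈⟨ +-congˡ {1ℤ} (+-identityˡ (x ^ suc r)) ⟩
      1ℤ + x ^ suc r ∎
      where
      t : Fin (suc (suc r)) → ℤ
      t = Bin.binomialTerm x 1ℤ (suc r)
      head≈ : t zero ≈ 1ℤ
      head≈ = trans (×-homo-1 _) (trans (*-identityˡ _) (1^n≈1 (suc r)))
      last≈ : t (suc (fromℕ r)) ≈ x ^ suc r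
      last≈ = begin
        (suc r C suc (toℕ (fromℕ r))) ⋆ (x ^ suc (toℕ (fromℕ r)) * 1ℤ ^ (r ∸ toℕ (fromℕ r)))
          ≡⟨ ≡.cong (λ k → (suc r C suc k) ⋆ (x ^ suc k * 1ℤ ^ (r ∸ k))) (toℕ-fromℕ r) ⟩
        (suc r C suc r) ⋆ (x ^ suc r * 1ℤ ^ (r ∸ r))
          ≡⟨ ≡.cong (_⋆ (x ^ suc r * 1ℤ ^ (r ∸ r))) (nCn≡1 (suc r)) ⟩
        1 ⋆ (x ^ suc r * 1ℤ ^ (r ∸ r))
          ≈⟨ ×-homo-1 _ ⟩
        x ^ suc r * 1ℤ ^ (r ∸ r)
          ≈⟨ *-congˡ {x ^ suc r} (1^n≈1 (r ∸ r)) ⟩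
        x ^ suc r * 1ℤ
          ≈⟨ *-identityʳ (x ^ suc r) ⟩
        x ^ suc r ∎
      middle≈ : sum (init (tail t)) ≈ 0ℤ
      middle≈ = trans
        (sum-cong-≋ {r} λ i → ∣⇒⋆≈0
          (≡.subst (λ n → p ∣ n C suc (toℕ (inject₁ i))) (≡.sym 1+r≡p)
            (prime∣C p-prime (s≤s z≤n)
              (≡.subst (suc (toℕ (inject₁ i)) <_) 1+r≡p
                (s≤s (≡.subst (_< r) (≡.sym (toℕ-inject₁ i)) (toℕ<n i)))))) _)
        (sum-replicate-zero r)

  -- Every class has a natural number as representative, and on natural numbers `frobenius` is the
  -- induction step.
  fermat : ∀ x → x ^ p ≈ x
  fermat x = begin
    x ^ p       ≈⟨ ^-congˡ p x≈n ⟩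
    (+ n) ^ p   ≈⟨ fermat-ℕ n ⟩
    + n         ≈⟨ x≈n ⟨
    x           ∎
    where
    n : ℕ
    n = x ℤ.%ℕ p
    fermat-ℕ : ∀ n → (+ n) ^ p ≈ + n
    fermat-ℕ zero    = 0^n≈0 p
    fermat-ℕ (suc n) = trans (frobenius (+ n)) (+-congˡ {1ℤ} (fermat-ℕ n))
    x≈n : x ≈ + n
    x≈n = begin
      x                              ≡⟨ ℤ.a≡a%ℕn+[a/ℕn]*n x p ⟩
      + n ℤ.+ (x ℤ./ℕ p) ℤ.* + p     ≈⟨ +-congˡ {+ n} (trans (*-congˡ {x ℤ./ℕ p} p≈0) (zeroʳ (x ℤ./ℕ p))) ⟩
      + n ℤ.+ 0ℤ                     ≡⟨ ℤ.+-identityʳ (+ n) ⟩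
      + n                            ∎

  fermat-≉0 : ∀ {x} → ¬ (x ≈ 0ℤ) → x ^ (p ∸ 1) ≈ 1ℤ
  fermat-≉0 {x} x≉0 = *-cancelˡ-≉0 x≉0 (begin
    x * x ^ (p ∸ 1)   ≡⟨ ≡.cong (x ^_) (ℕ.suc-pred p) ⟩
    x ^ p             ≈⟨ fermat x ⟩
    x                 ≈⟨ *-identityʳ x ⟨
    x * 1ℤ            ∎)

  -- The vector lists the non-leading coefficients, constant term first.
  monic : ∀ {n} → Vec ℤ n → ℤ → ℤ
  monic []      x = 1ℤ
  monic (e ∷ c) x = x * monic c x + e

  -- Synthetic division by x - r. For f(x) = x g(x) + e, the difference f(x) - f(r) equals x (g(x) -
  -- g(r)) + (x - r) g(r), so g(r) is the constant coefficient and the quotient for g supplies the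
  -- others.
  quotient : ∀ {n} → Vec ℤ (suc n) → ℤ → Vec ℤ n
  quotient (e ∷ [])        r = []
  quotient (e ∷ c@(_ ∷ _)) r = monic c r ∷ quotient c r

  monic-factor : ∀ {n} (c : Vec ℤ (suc n)) x r →
                 monic c x - monic c r ≈ (x - r) * monic (quotient c r) x
  monic-factor (e ∷ []) x r = reflexive (linear x r e)
    where
    linear : ∀ x r e → (x ℤ.* 1ℤ ℤ.+ e) ℤ.- (r ℤ.* 1ℤ ℤ.+ e) ≡ (x ℤ.- r) ℤ.* 1ℤ
    linear = solve-∀
  monic-factor (e ∷ c@(_ ∷ _)) x r = begin
    (x * monic c x + e) - (r * monic c r + e)
      ≡⟨ regroup x r e (monic c x) (monic c r) ⟩
    x * (monic c x - monic c r) + (x - r) * monic c r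
      ≈⟨ +-congʳ {(x - r) * monic c r} (*-congˡ {x} (monic-factor c x r)) ⟩
    x * ((x - r) * monic (quotient c r) x) + (x - r) * monic c r
      ≡⟨ factor-out x (x - r) (monic (quotient c r) x) (monic c r) ⟩
    (x - r) * (x * monic (quotient c r) x + monic c r) ∎
    where
    regroup : ∀ x r e g h → (x ℤ.* g ℤ.+ e) ℤ.- (r ℤ.* h ℤ.+ e) ≡ x ℤ.* (g ℤ.- h) ℤ.+ (x ℤ.- r) ℤ.* h
    regroup = solve-∀
    factor-out : ∀ x d q h → x ℤ.* (d ℤ.* q) ℤ.+ d ℤ.* h ≡ d ℤ.* (x ℤ.* q ℤ.+ h)
    factor-out = solve-∀

  1≉0 : ¬ (1ℤ ≈ 0ℤ)
  1≉0 = 0<+<p⇒≉0 (s≤s z≤n) (ℕ.nonTrivial⇒n>1 p {{prime⇒nonTrivial p-prime}})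

  -- Dividing by x - `r zero` keeps the remaining roots, as the field has no zero divisors, and
  -- keeps the leading coefficient 1, which finally stands alone and has no root.
  monic-roots : ∀ {n} (c : Vec ℤ n) (r : Fin (suc n) → ℤ) →
                (∀ i j → r i ≈ r j → i ≡ j) → ¬ (∀ i → monic c (r i) ≈ 0ℤ)
  monic-roots {zero}  []  r distinct root = 1≉0 (root zero)
  monic-roots {suc n} c r distinct root = monic-roots (quotient c (r zero)) (tail r)
    (λ i j ri≈rj → suc-injective (distinct _ _ ri≈rj))
    λ i → [ (λ ri-r0≈0 → ⊥-elim (0≢1+n (distinct zero (suc i) (sym (-≈0⇒≈ ri-r0≈0))))) , (λ q≈0 → q≈0) ]′
      (x*y≈0⇒x≈0⊎y≈0 _ _ (trans (sym (monic-factor c (r (suc i)) (r zero)))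
        (≈⇒-≈0 (trans (root (suc i)) (sym (root zero))))))

  power-monic : ∀ n x → monic (replicate n 0ℤ) x ≈ x ^ n
  power-monic zero x = refl
  power-monic (suc n) x = trans (+-identityʳ _) (*-congˡ {x} (power-monic n x))

  +-injective : ∀ {a b} → a < p → b < p → + a ≈ + b → a ≡ b
  +-injective {a} {b} a<p b<p a≈b =
    [ (λ a≤b → ≡.sym (ordered a≤b b<p (sym a≈b))) , (λ b≤a → ordered b≤a a<p a≈b) ]′ (ℕ.≤-total a b)
    where
    ordered : ∀ {a b} → b ≤ a → a < p → + a ≈ + b → a ≡ b
    ordered {a} {b} b≤a a<p a≈b with a ∸ b in eq
    ... | zero  = ℕ.≤-antisym (ℕ.m∸n≡0⇒m≤n eq) b≤a
    ... | suc d = ⊥-elim (0<+<p⇒≉0 {suc d} (s≤s z≤n) (ℕ.≤-<-trans (≡.subst (_≤ a) eq (ℕ.m∸n≤m a b)) a<p)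
      (trans (reflexive (≡.trans (≡.cong +_ (≡.sym eq)) (≡.trans (≡.sym (ℤ.⊖-≥ b≤a)) (≡.sym (ℤ.m-n≡m⊖n a b)))))
        (≈⇒-≈0 a≈b)))

  module OddPrime (h : ℕ) (p∸1≡m+m : p ∸ 1 ≡ suc h ℕ.+ suc h) where

    private
      m : ℕ
      m = suc h

    m+m<p : m ℕ.+ m < p
    m+m<p = ≡.subst (_< p) p∸1≡m+m (≡.subst (p ∸ 1 <_) (ℕ.suc-pred p) (ℕ.n<1+n _))

    x^m*x^m≈1 : ∀ {x} → ¬ (x ≈ 0ℤ) → x ^ m * x ^ m ≈ 1ℤ
    x^m*x^m≈1 {x} x≉0 = begin
      x ^ m * x ^ m    ≈⟨ ^-homo-* x m m ⟨
      x ^ (m ℕ.+ m)    ≡⟨ ≡.cong (x ^_) p∸1≡m+m ⟨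
      x ^ (p ∸ 1)      ≈⟨ fermat-≉0 x≉0 ⟩
      1ℤ               ∎

    x^m≈1⊎x^m≈-1 : ∀ {x} → ¬ (x ≈ 0ℤ) → x ^ m ≈ 1ℤ ⊎ x ^ m ≈ -1ℤ
    x^m≈1⊎x^m≈-1 {x} x≉0 = [ inj₁ ∘ -≈0⇒≈ , inj₂ ∘ -≈0⇒≈ ]′
      (x*y≈0⇒x≈0⊎y≈0 (x ^ m - 1ℤ) (x ^ m - -1ℤ)
        (trans (reflexive (difference-of-squares (x ^ m))) (≈⇒-≈0 (x^m*x^m≈1 x≉0))))
      where
      difference-of-squares : ∀ y → (y ℤ.- 1ℤ) ℤ.* (y ℤ.- -1ℤ) ≡ y ℤ.* y ℤ.- 1ℤ
      difference-of-squares = solve-∀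

    square^m≈1 : ∀ {w} → ¬ (w ≈ 0ℤ) → (w * w) ^ m ≈ 1ℤ
    square^m≈1 {w} w≉0 = trans (^-distrib-* w w m) (x^m*x^m≈1 w≉0)

    -- One of a - b and a + b is divisible by p, and 0 < a + b ≤ 2 m < p rules out the sum.
    square-injective : ∀ {a b} → 0 < a → a ≤ m → b ≤ m → + a * + a ≈ + b * + b → a ≡ b
    square-injective {a} {b} 0<a a≤m b≤m a²≈b² =
      [ (λ a-b≈0 → +-injective (≤m⇒<p a≤m) (≤m⇒<p b≤m) (-≈0⇒≈ a-b≈0))
      , (λ a+b≈0 → ⊥-elim (0<+<p⇒≉0 (ℕ.≤-trans 0<a (ℕ.m≤m+n a b)) (ℕ.≤-<-trans (ℕ.+-mono-≤ a≤m b≤m) m+m<p) a+b≈0))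
      ]′ (x*y≈0⇒x≈0⊎y≈0 (+ a - + b) (+ a + + b)
           (trans (reflexive (difference-of-squares (+ a) (+ b))) (≈⇒-≈0 a²≈b²)))
      where
      difference-of-squares : ∀ x y → (x ℤ.- y) ℤ.* (x ℤ.+ y) ≡ x ℤ.* x ℤ.- y ℤ.* y
      difference-of-squares = solve-∀
      ≤m⇒<p : ∀ {n} → n ≤ m → n < p
      ≤m⇒<p n≤m = ℕ.≤-<-trans (ℕ.≤-trans n≤m (ℕ.m≤m+n m m)) m+m<p

    -- The polynomial X^m - 1, given by the vector `-1ℤ ∷ replicate h 0ℤ`, already has the m
    -- distinct roots 1², ..., m²; a nonsquare root would be one too many.
    nonsquare^m≉1 : ∀ {x} → ¬ (∃[ y ] + p ℤ∣.∣ (+ toℕ {p} y ℤ.* + toℕ y ℤ.- x)) → ¬ (x ^ m ≈ 1ℤ)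
    nonsquare^m≉1 {x} nonsquare x^m≈1 = monic-roots (-1ℤ ∷ replicate h 0ℤ) r distinct root
      where
      s : Fin m → ℕ
      s i = suc (toℕ i)
      s<p : ∀ i → s i < p
      s<p i = ℕ.≤-<-trans (ℕ.≤-trans (toℕ<n i) (ℕ.m≤m+n m m)) m+m<p
      r : Fin (suc m) → ℤ
      r zero    = x
      r (suc i) = + s i * + s i
      x≉s² : ∀ i → ¬ (x ≈ + s i * + s i)
      x≉s² i x≈s² = nonsquare (fromℕ< (s<p i) ,
        ≡.subst (λ n → + p ℤ∣.∣ (+ n ℤ.* + n ℤ.- x)) (≡.sym (toℕ-fromℕ< (s<p i)))
          (_≡_[mod_].divisible (sym x≈s²)))
      distinct : ∀ i j → r i ≈ r j → i ≡ j
      distinct zero    zero    _ = ≡.refl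
      distinct zero    (suc j) e = ⊥-elim (x≉s² j e)
      distinct (suc i) zero    e = ⊥-elim (x≉s² i (sym e))
      distinct (suc i) (suc j) e = ≡.cong suc (toℕ-injective (ℕ.suc-injective
        (square-injective (s≤s z≤n) (toℕ<n i) (toℕ<n j) e)))
      root′ : ∀ {y : ℤ} → y ^ m ≈ 1ℤ → monic (-1ℤ ∷ replicate h 0ℤ) y ≈ 0ℤ
      root′ {y} y^m≈1 = ≈⇒-≈0 (trans (*-congˡ {y} (power-monic h y)) y^m≈1)
      root : ∀ i → monic (-1ℤ ∷ replicate h 0ℤ) (r i) ≈ 0ℤ
      root zero    = root′ {x} x^m≈1
      root (suc i) = root′ {r (suc i)} (square^m≈1 (0<+<p⇒≉0 (s≤s z≤n) (s<p i)))

    data LegendreView (x : ℤ) : Set where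
      divisible : + p ℤ∣.∣ x → legendre p x ≡ 0ℤ → LegendreView x
      square    : ¬ (+ p ℤ∣.∣ x) → ∃[ y ] + p ℤ∣.∣ (+ toℕ {p} y ℤ.* + toℕ y ℤ.- x) →
                  legendre p x ≡ 1ℤ → LegendreView x
      nonsquare : ¬ (+ p ℤ∣.∣ x) → ¬ (∃[ y ] + p ℤ∣.∣ (+ toℕ {p} y ℤ.* + toℕ y ℤ.- x)) →
                  legendre p x ≡ -1ℤ → LegendreView x

    legendreView : ∀ x → LegendreView x
    legendreView x = view (+ p ℤ∣.∣? x) (any? λ (y : Fin p) → + p ℤ∣.∣? (+ toℕ y ℤ.* + toℕ y ℤ.- x))
      where
      divides? = + p ℤ∣.∣? x
      square?  = any? λ (y : Fin p) → + p ℤ∣.∣? (+ toℕ y ℤ.* + toℕ y ℤ.- x)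
      -- The body of `legendre` with both decisions abstracted, so that each can be replaced by its
      -- known truth value.
      value : Bool → Bool → ℤ
      value d s = if d then 0ℤ else if s then 1ℤ else -1ℤ
      view : Dec _ → Dec _ → LegendreView x
      view (yes d) _       = divisible d (≡.cong (λ b → value b (does square?)) (dec-true divides? d))
      view (no ¬d) (yes s) = square ¬d s (≡.cong₂ value (dec-false divides? ¬d) (dec-true square? s))
      view (no ¬d) (no ¬s) = nonsquare ¬d ¬s (≡.cong₂ value (dec-false divides? ¬d) (dec-false square? ¬s))

    euler : ∀ x → legendre p x ≈ x ^ m
    euler x with legendreView x
    ... | divisible p∣x eq = trans (reflexive eq) (sym (trans (^-congˡ m (∣⇒≈0 p∣x)) (0^n≈0 m)))
    ... | square p∤x (y , p∣y²-x) eq =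
      trans (reflexive eq) (sym (trans (^-congˡ m (sym y²≈x)) (square^m≈1 y≉0)))
      where
      y²≈x : + toℕ y * + toℕ y ≈ x
      y²≈x = congruent p∣y²-x
      y≉0 : ¬ (+ toℕ y ≈ 0ℤ)
      y≉0 y≈0 = p∤x (≈0⇒∣ (trans (sym y²≈x) (trans (*-congʳ {+ toℕ y} y≈0) (zeroˡ (+ toℕ y)))))
    ... | nonsquare p∤x ¬square eq = trans (reflexive eq)
      ([ ⊥-elim ∘ nonsquare^m≉1 ¬square , sym ]′ (x^m≈1⊎x^m≈-1 (p∤x ∘ ≈0⇒∣)))

    2<p : 2 < p
    2<p = ℕ.≤-<-trans (s≤s (≡.subst (1 ≤_) (≡.sym (ℕ.+-suc h h)) (s≤s z≤n))) m+m<p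

    -- Euler's criterion compares symbols only modulo p. Since p > 2, the values 0, 1 and -1 are
    -- distinct there, which turns the congruence into an equality of integers.
    legendre-injective : ∀ x y → legendre p x ≈ legendre p y → legendre p x ≡ legendre p y
    legendre-injective x y e = classify (values x) (values y)
      where
      values : ∀ x → legendre p x ≡ 0ℤ ⊎ legendre p x ≡ 1ℤ ⊎ legendre p x ≡ -1ℤ
      values x with legendreView x
      ... | divisible _ eq   = inj₁ eq
      ... | square _ _ eq    = inj₂ (inj₁ eq)
      ... | nonsquare _ _ eq = inj₂ (inj₂ eq)
      -1≉0 : ¬ (-1ℤ ≈ 0ℤ)
      -1≉0 e = 1≉0 (-‿cong { -1ℤ} {0ℤ} e)
      1≉-1 : ¬ (1ℤ ≈ -1ℤ)
      1≉-1 e = 0<+<p⇒≉0 {2} (s≤s z≤n) 2<p (≈⇒-≈0 e)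
      contradict : ∀ {u v} {A : Set} → legendre p x ≡ u → legendre p y ≡ v → ¬ (u ≈ v) → A
      contradict ≡u ≡v u≉v = ⊥-elim (u≉v (trans (reflexive (≡.sym ≡u)) (trans e (reflexive ≡v))))
      classify : _ → _ → legendre p x ≡ legendre p y
      classify (inj₁ a)        (inj₁ b)        = ≡.trans a (≡.sym b)
      classify (inj₁ a)        (inj₂ (inj₁ b)) = contradict a b (1≉0 ∘ sym)
      classify (inj₁ a)        (inj₂ (inj₂ b)) = contradict a b (-1≉0 ∘ sym)
      classify (inj₂ (inj₁ a)) (inj₁ b)        = contradict a b 1≉0
      classify (inj₂ (inj₁ a)) (inj₂ (inj₁ b)) = ≡.trans a (≡.sym b)
      classify (inj₂ (inj₁ a)) (inj₂ (inj₂ b)) = contradict a b 1≉-1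
      classify (inj₂ (inj₂ a)) (inj₁ b)        = contradict a b -1≉0
      classify (inj₂ (inj₂ a)) (inj₂ (inj₁ b)) = contradict a b (1≉-1 ∘ sym)
      classify (inj₂ (inj₂ a)) (inj₂ (inj₂ b)) = ≡.trans a (≡.sym b)

-- Trinomial coefficients and evaluation of integer polynomials.

module Trinomials where
  open import Data.List using ([]; _∷_; map)

  coeff-+ : ∀ f g k → coeff (f +ᴾ g) k ≡ coeff f k ℤ.+ coeff g k
  coeff-+ []      g       k       = ≡.sym (ℤ.+-identityˡ _)
  coeff-+ (a ∷ f) []      k       = ≡.sym (ℤ.+-identityʳ _)
  coeff-+ (a ∷ f) (b ∷ g) zero    = ≡.refl
  coeff-+ (a ∷ f) (b ∷ g) (suc k) = coeff-+ f g k

  coeff-map : ∀ a f k → coeff (map (a ℤ.*_) f) k ≡ a ℤ.* coeff f k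
  coeff-map a []      k       = ≡.sym (ℤ.*-zeroʳ a)
  coeff-map a (b ∷ f) zero    = ≡.refl
  coeff-map a (b ∷ f) (suc k) = coeff-map a f k

  1+X+X² : Poly
  1+X+X² = 1ℤ ∷ 1ℤ ∷ 1ℤ ∷ []

  trinomial : ℕ → ℕ → ℤ
  trinomial n k = coeff (1+X+X² ^ᴾ n) k

  -- The two leading zeros make the three-term recurrence uniform in k.
  padded : ℕ → ℕ → ℤ
  padded n zero          = 0ℤ
  padded n (suc zero)    = 0ℤ
  padded n (suc (suc k)) = trinomial n k

  trinomial-suc : ∀ n k → trinomial (suc n) k ≡
                  padded n (suc (suc k)) ℤ.+ (padded n (suc k) ℤ.+ padded n k)
  trinomial-suc n k = ≡.trans (top k) (≡.cong (λ x → trinomial n k ℤ.+ x) (middle k))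
    where
    P = 1+X+X² ^ᴾ n
    scaled : ∀ k → coeff (map (1ℤ ℤ.*_) P) k ≡ trinomial n k
    scaled k = ≡.trans (coeff-map 1ℤ P k) (ℤ.*-identityˡ _)
    low : ∀ k → coeff (map (1ℤ ℤ.*_) P +ᴾ (0ℤ ∷ [])) k ≡ trinomial n k
    low k = ≡.trans (coeff-+ (map (1ℤ ℤ.*_) P) (0ℤ ∷ []) k)
              (≡.trans (≡.cong₂ ℤ._+_ (scaled k) (0∷[] k)) (ℤ.+-identityʳ _))
      where
      0∷[] : ∀ k → coeff (0ℤ ∷ []) k ≡ 0ℤ
      0∷[] zero    = ≡.refl
      0∷[] (suc k) = ≡.refl
    shift : ∀ f k → coeff (map (1ℤ ℤ.*_) P +ᴾ (0ℤ ∷ f)) k ≡ trinomial n k ℤ.+ coeff (0ℤ ∷ f) k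
    shift f k = ≡.trans (coeff-+ (map (1ℤ ℤ.*_) P) (0ℤ ∷ f) k)
                  (≡.cong (λ x → x ℤ.+ coeff (0ℤ ∷ f) k) (scaled k))
    top : ∀ k → trinomial (suc n) k ≡
          trinomial n k ℤ.+ coeff (0ℤ ∷ (map (1ℤ ℤ.*_) P +ᴾ (0ℤ ∷ (map (1ℤ ℤ.*_) P +ᴾ (0ℤ ∷ []))))) k
    top = shift _
    middle : ∀ k → coeff (0ℤ ∷ (map (1ℤ ℤ.*_) P +ᴾ (0ℤ ∷ (map (1ℤ ℤ.*_) P +ᴾ (0ℤ ∷ []))))) k ≡
             padded n (suc k) ℤ.+ padded n k
    middle zero          = ≡.refl
    middle (suc zero)    = shift _ zero
    middle (suc (suc k)) = ≡.trans (shift _ (suc k)) (≡.cong (λ x → trinomial n (suc k) ℤ.+ x) (low k))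

  padded-vanishes : ∀ n k → suc (suc (n ℕ.+ n)) < k → padded n k ≡ 0ℤ
  trinomial-vanishes : ∀ n k → n ℕ.+ n < k → trinomial n k ≡ 0ℤ

  padded-vanishes n zero          _             = ≡.refl
  padded-vanishes n (suc zero)    _             = ≡.refl
  padded-vanishes n (suc (suc k)) (s≤s (s≤s l)) = trinomial-vanishes n k l

  trinomial-vanishes zero    (suc k) _ = ≡.refl
  trinomial-vanishes (suc n) k l = ≡.trans (trinomial-suc n k)
    (≡.cong₂ ℤ._+_ (padded-vanishes n (suc (suc k)) (ℕ.m≤n⇒m≤1+n (ℕ.m≤n⇒m≤1+n l′)))
      (≡.cong₂ ℤ._+_ (padded-vanishes n (suc k) (ℕ.m≤n⇒m≤1+n l′)) (padded-vanishes n k l′)))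
    where
    l′ : suc (suc (n ℕ.+ n)) < k
    l′ = ≡.subst (_< k) (≡.cong suc (ℕ.+-suc n n)) l

  -- The recurrence reads the same backwards. In `padded n` mirrored indices add up to 2 n + 4, and
  -- the two leading zeros mirror the vanishing coefficients just above degree 2 n.
  trinomial-palindrome : ∀ n i j → i ℕ.+ j ≡ n ℕ.+ n → trinomial n i ≡ trinomial n j
  trinomial-palindrome zero zero zero i+j≡0 = ≡.refl
  trinomial-palindrome (suc n) i j i+j≡ = begin
    trinomial (suc n) i
      ≡⟨ trinomial-suc n i ⟩
    padded n (suc (suc i)) ℤ.+ (padded n (suc i) ℤ.+ padded n i)
      ≡⟨ ≡.cong₂ ℤ._+_ (padded-palindrome (suc (suc i)) j total)
           (≡.cong₂ ℤ._+_ (padded-palindrome (suc i) (suc j) (≡.trans (ℕ.+-suc (suc i) j) total))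
                          (padded-palindrome i (suc (suc j))
                            (≡.trans (ℕ.+-suc i (suc j)) (≡.trans (ℕ.+-suc (suc i) j) total)))) ⟩
    padded n j ℤ.+ (padded n (suc j) ℤ.+ padded n (suc (suc j)))
      ≡⟨ reverse (padded n j) (padded n (suc j)) (padded n (suc (suc j))) ⟩
    padded n (suc (suc j)) ℤ.+ (padded n (suc j) ℤ.+ padded n j)
      ≡⟨ trinomial-suc n j ⟨
    trinomial (suc n) j ∎
    where
    open ≡.≡-Reasoning
    reverse : ∀ a b c → a ℤ.+ (b ℤ.+ c) ≡ c ℤ.+ (b ℤ.+ a)
    reverse = solve-∀
    total : suc (suc (i ℕ.+ j)) ≡ suc (suc (suc (suc (n ℕ.+ n))))
    total = ≡.cong (λ k → suc (suc k)) (≡.trans i+j≡ (≡.cong suc (ℕ.+-suc n n)))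
    padded-palindrome : ∀ i j → i ℕ.+ j ≡ suc (suc (suc (suc (n ℕ.+ n)))) → padded n i ≡ padded n j
    padded-palindrome zero j ≡.refl = ≡.sym (padded-vanishes n j (s≤s (s≤s (s≤s (ℕ.n≤1+n _)))))
    padded-palindrome (suc zero) (suc j) ≡.refl = ≡.sym (padded-vanishes n (suc j) ℕ.≤-refl)
    padded-palindrome (suc (suc i)) zero eq =
      padded-vanishes n (suc (suc i)) (ℕ.≤-trans (ℕ.n≤1+n _) (ℕ.≤-reflexive (≡.trans (≡.sym eq) (ℕ.+-identityʳ _))))
    padded-palindrome (suc (suc i)) (suc zero) eq =
      padded-vanishes n (suc (suc i)) (ℕ.≤-reflexive (≡.cong ℕ.pred (≡.trans (≡.sym eq) (ℕ.+-comm (suc (suc i)) 1))))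
    padded-palindrome (suc (suc i)) (suc (suc j)) eq = trinomial-palindrome n i j
      (ℕ.+-cancelˡ-≡ 4 (i ℕ.+ j) (n ℕ.+ n) (≡.trans (≡.sym (ℕ-shift i j)) eq))
      where
      ℕ-shift : ∀ i j → suc (suc i) ℕ.+ suc (suc j) ≡ 4 ℕ.+ (i ℕ.+ j)
      ℕ-shift = ℕ-RingSolver.solve-∀

  trinomial-0 : ∀ n → trinomial n 0 ≡ 1ℤ
  trinomial-0 zero    = ≡.refl
  trinomial-0 (suc n) = ≡.trans (trinomial-suc n 0)
    (≡.cong (λ x → x ℤ.+ 0ℤ) (trinomial-0 n))

  trinomial-1 : ∀ n → trinomial n 1 ≡ + n
  trinomial-1 zero    = ≡.refl
  trinomial-1 (suc n) = ≡.trans (trinomial-suc n 1)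
    (≡.trans (≡.cong₂ (λ x y → x ℤ.+ (y ℤ.+ 0ℤ)) (trinomial-1 n) (trinomial-0 n)) (≡.cong +_ (ℕ.+-comm n 1)))

  eval : Poly → ℤ → ℤ
  eval []      t = 0ℤ
  eval (a ∷ f) t = a ℤ.+ t ℤ.* eval f t

  eval-+ : ∀ f g t → eval (f +ᴾ g) t ≡ eval f t ℤ.+ eval g t
  eval-+ []      g       t = ≡.sym (ℤ.+-identityˡ _)
  eval-+ (a ∷ f) []      t = ≡.sym (ℤ.+-identityʳ _)
  eval-+ (a ∷ f) (b ∷ g) t = ≡.trans (≡.cong (λ x → a ℤ.+ b ℤ.+ t ℤ.* x) (eval-+ f g t))
    (regroup a b t (eval f t) (eval g t))
    where
    regroup : ∀ a b t x y → a ℤ.+ b ℤ.+ t ℤ.* (x ℤ.+ y) ≡ (a ℤ.+ t ℤ.* x) ℤ.+ (b ℤ.+ t ℤ.* y)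
    regroup = solve-∀

  eval-map : ∀ a f t → eval (map (a ℤ.*_) f) t ≡ a ℤ.* eval f t
  eval-map a []      t = ≡.sym (ℤ.*-zeroʳ a)
  eval-map a (b ∷ f) t = ≡.trans (≡.cong (λ x → a ℤ.* b ℤ.+ t ℤ.* x) (eval-map a f t))
    (regroup a b t (eval f t))
    where
    regroup : ∀ a b t x → a ℤ.* b ℤ.+ t ℤ.* (a ℤ.* x) ≡ a ℤ.* (b ℤ.+ t ℤ.* x)
    regroup = solve-∀

  eval-* : ∀ f g t → eval (f *ᴾ g) t ≡ eval f t ℤ.* eval g t
  eval-* []      g t = ≡.sym (ℤ.*-zeroˡ (eval g t))
  eval-* (a ∷ f) g t = ≡.trans (eval-+ (map (a ℤ.*_) g) (0ℤ ∷ (f *ᴾ g)) t)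
    (≡.trans (≡.cong₂ (λ x y → x ℤ.+ (0ℤ ℤ.+ t ℤ.* y)) (eval-map a g t) (eval-* f g t))
      (regroup a t (eval f t) (eval g t)))
    where
    regroup : ∀ a t x y → a ℤ.* y ℤ.+ (0ℤ ℤ.+ t ℤ.* (x ℤ.* y)) ≡ (a ℤ.+ t ℤ.* x) ℤ.* y
    regroup = solve-∀

-- Polynomial values as power sums modulo p.

module PolynomialSums (p : ℕ) where
  open import Data.List using ([]; _∷_)
  open Trinomials using (eval; eval-*)
  open ModularRing p
  open SemiringSum semiring
    using (sum; sum-cong-≋; sum-replicate-zero; *-distribˡ-sum)
  open SetoidReasoning setoid

  eval-^ : ∀ f n t → eval (f ^ᴾ n) t ≡ eval f t ^ n
  eval-^ f zero    t = ≡.trans (≡.cong (λ x → 1ℤ ℤ.+ x) (ℤ.*-zeroʳ t)) ≡.refl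
  eval-^ f (suc n) t = ≡.trans (eval-* f (f ^ᴾ n) t) (≡.cong (λ x → eval f t ℤ.* x) (eval-^ f n t))

  -- The bound `L` is on the nonvanishing coefficients and not on the list, so the number of
  -- summands can be prescribed.
  eval-sum : ∀ L f t → (∀ k → L ≤ k → coeff f k ≡ 0ℤ) →
             eval f t ≈ sum {L} (λ k → coeff f (toℕ k) * t ^ toℕ k)
  eval-sum zero f t vanishes = reflexive (eval-zero f (λ k → vanishes k z≤n))
    where
    eval-zero : ∀ f → (∀ k → coeff f k ≡ 0ℤ) → eval f t ≡ 0ℤ
    eval-zero []      _ = ≡.refl
    eval-zero (a ∷ f) v = ≡.cong₂ ℤ._+_ (v 0)
      (≡.trans (≡.cong (λ x → t ℤ.* x) (eval-zero f (v ∘ suc))) (ℤ.*-zeroʳ t))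
  eval-sum (suc L) [] t vanishes =
    sym (trans (sum-cong-≋ {suc L} {λ k → 0ℤ * t ^ toℕ k} (λ k → zeroˡ (t ^ toℕ k))) (sum-replicate-zero (suc L)))
  eval-sum (suc L) (a ∷ f) t vanishes = begin
    a + t * eval f t
      ≈⟨ +-cong {a} {a * 1ℤ} (sym (*-identityʳ a))
           (*-congˡ {t} (eval-sum L f t (λ k L≤k → vanishes (suc k) (s≤s L≤k)))) ⟩
    a * 1ℤ + t * sum {L} (λ k → coeff f (toℕ k) * t ^ toℕ k)
      ≈⟨ +-congˡ {a * 1ℤ} (*-distribˡ-sum {L} t (λ k → coeff f (toℕ k) * t ^ toℕ k)) ⟩
    a * 1ℤ + sum {L} (λ k → t * (coeff f (toℕ k) * t ^ toℕ k))
      ≈⟨ +-congˡ {a * 1ℤ} (sum-cong-≋ {L} λ k → reflexive (swap t (coeff f (toℕ k)) (t ^ toℕ k))) ⟩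
    a * 1ℤ + sum {L} (λ k → coeff f (toℕ k) * (t * t ^ toℕ k)) ∎
    where
    swap : ∀ t c y → t ℤ.* (c ℤ.* y) ≡ c ℤ.* (t ℤ.* y)
    swap = solve-∀

-- Powers of x² + x y + y² as a matrix product.

double-2+ : ∀ {n} h → n ≡ 2 ℕ.+ h → n ℕ.+ n ≡ 4 ℕ.+ (h ℕ.+ h)
double-2+ h ≡.refl = ≡.cong (2 ℕ.+_) (≡.trans (ℕ.+-suc h (suc h)) (≡.cong suc (ℕ.+-suc h h)))

module QuadraticPowers {ℓ₁ ℓ₂} (R : CommutativeRing ℓ₁ ℓ₂) where
  open CommutativeRing R hiding (zero)
  open SemiringExp semiring using (_^_; ^-congˡ; ^-homo-*; ^-assocʳ)
  open CommutativeSemiringExp commutativeSemiring using (^-distrib-*)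
  open SemiringSum semiring
    using (sum; sum-cong-≋; sum-replicate-zero; sum-init-last; ∑-distrib-+; *-distribˡ-sum)
  open MonoidSum *-commutativeMonoid using () renaming (sum to product)
  open SemiringSolver commutativeSemiring using (solve; con; _:=_; _:+_; _:*_)
  open Determinants R
  open Determinant R using (det)
  open SetoidReasoning setoid

  -- The Kronecker delta on natural numbers. It adds the folded coefficients to the two ends of `β`,
  -- which has to be a function on ℕ for `product-palindrome`.
  κ : ℕ → ℕ → Carrier
  κ zero    zero    = 1#
  κ zero    (suc j) = 0#
  κ (suc i) zero    = 0#
  κ (suc i) (suc j) = κ i j

  κ-sym : ∀ i j → κ i j ≡ κ j i
  κ-sym zero    zero    = ≡.refl
  κ-sym zero    (suc j) = ≡.refl
  κ-sym (suc i) zero    = ≡.refl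
  κ-sym (suc i) (suc j) = κ-sym i j

  κ-+ : ∀ k i → κ (k ℕ.+ i) k ≡ κ 0 i
  κ-+ zero    i = κ-sym i 0
  κ-+ (suc k) i = κ-+ k i

  sum-κ : ∀ {n} j → j < n → (z : ℕ → Carrier) → sum {n} (λ i → κ j (toℕ i) * z (toℕ i)) ≈ z j
  sum-κ {suc n} zero _ z = trans
    (+-cong (*-identityˡ (z 0)) (trans (sum-cong-≋ {n} λ i → zeroˡ _) (sum-replicate-zero n)))
    (+-identityʳ (z 0))
  sum-κ {suc n} (suc j) (s≤s j<n) z = trans
    (+-cong (zeroˡ (z 0)) (sum-κ j j<n (z ∘ suc))) (+-identityˡ (z (suc j)))

  δ-opposite : ∀ {n} (u v : Fin n) → δ (opposite u) v ≡ δ u (opposite v)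
  δ-opposite u v with opposite u ≟ v
  ... | yes ≡.refl = ≡.trans (δ-refl (opposite u)) (≡.sym (≡.trans (≡.cong (δ u) (opposite-involutive u)) (δ-refl u)))
  ... | no opp-u≢v = ≡.trans (δ-≢ opp-u≢v)
    (≡.sym (δ-≢ λ u≡opp-v → opp-u≢v (≡.trans (≡.cong opposite u≡opp-v) (opposite-involutive v))))

  quadratic : Carrier → Carrier → Carrier
  quadratic x y = x * x + x * y + y * y

  -- `c` stands for the trinomial coefficients of exponent `n`. The 5 + 2 h summands are the
  -- exponents 0, ..., 2 n.
  module _ (h : ℕ) (n : ℕ) (n≡2+h : n ≡ 2 ℕ.+ h) (c : ℕ → Carrier)
           (c-palindrome : ∀ i j → i ℕ.+ j ≡ n ℕ.+ n → c i ≈ c j)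
           (expansion : ∀ t → (1# + t + t * t) ^ n ≈ sum {5 ℕ.+ (h ℕ.+ h)} (λ k → c (toℕ k) * t ^ toℕ k))
           where

    private
      N : ℕ
      N = suc (h ℕ.+ h)

    n+n≡3+N : n ℕ.+ n ≡ 3 ℕ.+ N
    n+n≡3+N = double-2+ h n≡2+h

    -- For x ^ (p - 1) = y ^ (p - 1) = 1 with p = 2 + N, the monomials x y ^ p and x ^ p y
    -- coincide, and x ^ (p + 1) and y ^ (p + 1) fold onto x ^ 2 y ^ (p - 1) and
    -- x ^ (p - 1) y ^ 2: d is the coefficient of x y and β v that of x ^ (p - 1 - v) y ^ (2 + v).
    d : Carrier
    d = c 1 + c (2 ℕ.+ N)

    β : ℕ → Carrier
    β v = c (2 ℕ.+ v) + (κ 0 v * c (3 ℕ.+ N) + κ (h ℕ.+ h) v * c 0)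

    fold : ∀ t → t ^ suc N ≈ 1# →
           (sum {4 ℕ.+ N} λ k → c (toℕ k) * t ^ toℕ k) ≈
           d * t + sum {N} λ v → β (toℕ v) * t ^ (2 ℕ.+ toℕ v)
    fold t t^[1+N]≈1 = begin
      c 0 * 1# + (c 1 * (t * 1#) + sum {2 ℕ.+ N} z)
        ≈⟨ +-congˡ (+-congˡ split-top) ⟩
      c 0 * 1# + (c 1 * (t * 1#) + ((Σc + c (2 ℕ.+ N) * t ^ (2 ℕ.+ N)) + c (3 ℕ.+ N) * t ^ (3 ℕ.+ N)))
        -- The exponent 0 is raised to 1 + N while 2 + N and 3 + N drop to 1 and 2, so that all
        -- exponents lie between 1 and 1 + N = p - 1.
        ≈⟨ +-cong (*-congˡ (sym t^[1+N]≈1)) (+-congˡ (+-cong (+-congˡ (*-congˡ (*-congˡ t^[1+N]≈1)))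
             (*-congˡ (*-congˡ (*-congˡ t^[1+N]≈1))))) ⟩
      c 0 * t ^ suc N + (c 1 * (t * 1#) + ((Σc + c (2 ℕ.+ N) * (t * 1#)) + c (3 ℕ.+ N) * (t * (t * 1#))))
        ≈⟨ solve 7 (λ a b e f t u s →
             a :* u :+ (b :* (t :* con 1) :+ ((s :+ e :* (t :* con 1)) :+ f :* (t :* (t :* con 1)))) :=
             (b :+ e) :* t :+ (s :+ ((t :* (t :* con 1)) :* f :+ u :* a)))
             refl (c 0) (c 1) (c (2 ℕ.+ N)) (c (3 ℕ.+ N)) t (t ^ suc N) Σc ⟩
      d * t + (Σc + (t ^ 2 * c (3 ℕ.+ N) + t ^ suc N * c 0))
        -- Each of the two folded monomials becomes a sum over `v` with one surviving term, ready to
        -- be merged into `β`.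
        ≈⟨ +-congˡ (+-congˡ (+-cong (pick 0 (s≤s z≤n) (c (3 ℕ.+ N))) (pick (h ℕ.+ h) ℕ.≤-refl (c 0)))) ⟨
      d * t + (Σc + (Σκ 0 (c (3 ℕ.+ N)) + Σκ (h ℕ.+ h) (c 0)))
        ≈⟨ +-congˡ (trans (∑-distrib-+ cᵥ (λ v → κᵥ 0 (c (3 ℕ.+ N)) v + κᵥ (h ℕ.+ h) (c 0) v))
             (+-congˡ (∑-distrib-+ (κᵥ 0 (c (3 ℕ.+ N))) (κᵥ (h ℕ.+ h) (c 0))))) ⟨
      d * t + sum {N} (λ v → cᵥ v + (κᵥ 0 (c (3 ℕ.+ N)) v + κᵥ (h ℕ.+ h) (c 0) v))
        ≈⟨ +-congˡ (sum-cong-≋ {N} λ v → solve 6 (λ a u k l e f →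
             a :* u :+ (k :* (u :* e) :+ l :* (u :* f)) := (a :+ (k :* e :+ l :* f)) :* u) refl
             (c (2 ℕ.+ toℕ v)) (t ^ (2 ℕ.+ toℕ v)) (κ 0 (toℕ v)) (κ (h ℕ.+ h) (toℕ v)) (c (3 ℕ.+ N)) (c 0)) ⟩
      d * t + sum {N} (λ v → β (toℕ v) * t ^ (2 ℕ.+ toℕ v)) ∎
      where
      z : Fin (2 ℕ.+ N) → Carrier
      z k = c (2 ℕ.+ toℕ k) * t ^ (2 ℕ.+ toℕ k)
      cᵥ : Fin N → Carrier
      cᵥ v = c (2 ℕ.+ toℕ v) * t ^ (2 ℕ.+ toℕ v)
      κᵥ : ℕ → Carrier → Fin N → Carrier
      κᵥ j a v = κ j (toℕ v) * (t ^ (2 ℕ.+ toℕ v) * a)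
      Σc : Carrier
      Σc = sum cᵥ
      Σκ : ℕ → Carrier → Carrier
      Σκ j a = sum (κᵥ j a)
      pick : ∀ j → j < N → ∀ a → Σκ j a ≈ t ^ (2 ℕ.+ j) * a
      pick j j<N a = sum-κ {N} j j<N (λ v → t ^ (2 ℕ.+ v) * a)
      term : ∀ {k l} → k ≡ l → c (2 ℕ.+ k) * t ^ (2 ℕ.+ k) ≈ c (2 ℕ.+ l) * t ^ (2 ℕ.+ l)
      term ≡.refl = refl
      split-top : sum z ≈ (Σc + c (2 ℕ.+ N) * t ^ (2 ℕ.+ N)) + c (3 ℕ.+ N) * t ^ (3 ℕ.+ N)
      split-top = trans (sum-init-last z)
        (+-cong (trans (sum-init-last (init z))
                  (+-cong (sum-cong-≋ {N} λ v → term (≡.trans (toℕ-inject₁ (inject₁ v)) (toℕ-inject₁ v)))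
                          (term (≡.trans (toℕ-inject₁ (fromℕ N)) (toℕ-fromℕ N)))))
                (term (toℕ-fromℕ (suc N))))

    module _ {x y : Carrier} (x^[1+N]≈1 : x ^ suc N ≈ 1#) (y^[1+N]≈1 : y ^ suc N ≈ 1#) where
      private
        t : Carrier
        -- This is y / x, since x^(1+N) = 1 makes x^N the inverse of x.
        t = x ^ N * y

        x*t≈y : x * t ≈ y
        x*t≈y = begin
          x * (x ^ N * y)  ≈⟨ *-assoc x (x ^ N) y ⟨
          x ^ suc N * y    ≈⟨ *-congʳ x^[1+N]≈1 ⟩
          1# * y           ≈⟨ *-identityˡ y ⟩
          y                ∎

        1^k≈1 : ∀ k → 1# ^ k ≈ 1#
        1^k≈1 zero    = refl
        1^k≈1 (suc k) = trans (*-identityˡ _) (1^k≈1 k)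

        t^[1+N]≈1 : t ^ suc N ≈ 1#
        t^[1+N]≈1 = begin
          (x ^ N * y) ^ suc N          ≈⟨ ^-distrib-* (x ^ N) y (suc N) ⟩
          (x ^ N) ^ suc N * y ^ suc N  ≈⟨ *-cong (^-assocʳ x N (suc N)) y^[1+N]≈1 ⟩
          x ^ (N ℕ.* suc N) * 1#       ≈⟨ *-identityʳ _ ⟩
          x ^ (N ℕ.* suc N)            ≡⟨ ≡.cong (x ^_) (ℕ.*-comm N (suc N)) ⟩
          x ^ (suc N ℕ.* N)            ≈⟨ ^-assocʳ x (suc N) N ⟨
          (x ^ suc N) ^ N              ≈⟨ ^-congˡ N x^[1+N]≈1 ⟩
          1# ^ N                       ≈⟨ 1^k≈1 N ⟩
          1#                           ∎

        x^[3+N]≈x² : x ^ (3 ℕ.+ N) ≈ x * x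
        x^[3+N]≈x² = *-congˡ (trans (*-congˡ x^[1+N]≈1) (*-identityʳ x))

        quadratic≈ : quadratic x y ≈ (x * x) * (1# + t + t * t)
        quadratic≈ = trans
          (+-cong (+-congˡ (*-congˡ (sym x*t≈y))) (*-cong (sym x*t≈y) (sym x*t≈y)))
          (solve 2 (λ x t → x :* x :+ x :* (x :* t) :+ (x :* t) :* (x :* t) :=
             (x :* x) :* (con 1 :+ t :+ t :* t)) refl x t)

        x^2n≈x² : (x * x) ^ n ≈ x * x
        x^2n≈x² = begin
          (x * x) ^ n    ≈⟨ ^-distrib-* x x n ⟩
          x ^ n * x ^ n  ≈⟨ ^-homo-* x n n ⟨
          x ^ (n ℕ.+ n)  ≡⟨ ≡.cong (x ^_) n+n≡3+N ⟩
          x ^ (3 ℕ.+ N)  ≈⟨ x^[3+N]≈x² ⟩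
          x * x          ∎

        -- Homogenisation: x² is read back as x^(3+N) = x^u x^k with u + k = 3 + N, and x^k t^k is
        -- y^k.
        monomial : ∀ v → (x * x) * (β (toℕ v) * t ^ (2 ℕ.+ toℕ v)) ≈
                   x ^ (2 ℕ.+ toℕ (opposite {N} v)) * β (toℕ v) * y ^ (2 ℕ.+ toℕ v)
        monomial v = begin
          (x * x) * (b * t ^ k)        ≈⟨ *-congʳ x^[3+N]≈x² ⟨
          x ^ (3 ℕ.+ N) * (b * t ^ k)  ≡⟨ ≡.cong (λ e → x ^ e * (b * t ^ k)) u+k≡3+N ⟨
          x ^ (u ℕ.+ k) * (b * t ^ k)  ≈⟨ *-congʳ (^-homo-* x u k) ⟩
          x ^ u * x ^ k * (b * t ^ k)
            ≈⟨ solve 4 (λ u k b s → u :* k :* (b :* s) := u :* b :* (k :* s)) refl (x ^ u) (x ^ k) b (t ^ k) ⟩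
          x ^ u * b * (x ^ k * t ^ k)  ≈⟨ *-congˡ (trans (sym (^-distrib-* x t k)) (^-congˡ k x*t≈y)) ⟩
          x ^ u * b * y ^ k            ∎
          where
          b = β (toℕ v)
          k = 2 ℕ.+ toℕ v
          u = 2 ℕ.+ toℕ (opposite v)
          u+k≡3+N : u ℕ.+ k ≡ 3 ℕ.+ N
          u+k≡3+N = ≡.trans (move (toℕ (opposite v)) (toℕ v))
            (≡.cong (3 ℕ.+_) (≡.trans (≡.cong (ℕ._+ suc (toℕ v)) (opposite-prop v)) (ℕ.m∸n+n≡m (toℕ<n v))))
            where
            move : ∀ a b → suc (suc a) ℕ.+ suc (suc b) ≡ 3 ℕ.+ (a ℕ.+ suc b)
            move = ℕ-RingSolver.solve-∀

      quadratic-power : quadratic x y ^ n ≈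
        x * d * y + sum {N} λ v → x ^ (2 ℕ.+ toℕ (opposite v)) * β (toℕ v) * y ^ (2 ℕ.+ toℕ v)
      quadratic-power = begin
        quadratic x y ^ n
          ≈⟨ ^-congˡ n quadratic≈ ⟩
        ((x * x) * (1# + t + t * t)) ^ n
          ≈⟨ ^-distrib-* (x * x) (1# + t + t * t) n ⟩
        (x * x) ^ n * (1# + t + t * t) ^ n
          ≈⟨ *-cong x^2n≈x² (trans (expansion t) (fold t t^[1+N]≈1)) ⟩
        (x * x) * (d * t + sum {N} (λ v → β (toℕ v) * t ^ (2 ℕ.+ toℕ v)))
          ≈⟨ distribˡ (x * x) (d * t) _ ⟩
        (x * x) * (d * t) + (x * x) * sum {N} (λ v → β (toℕ v) * t ^ (2 ℕ.+ toℕ v))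
          ≈⟨ +-cong
               (trans (solve 3 (λ x d t → (x :* x) :* (d :* t) := x :* d :* (x :* t)) refl x d t) (*-congˡ x*t≈y))
               (trans (*-distribˡ-sum {N} (x * x) (λ v → β (toℕ v) * t ^ (2 ℕ.+ toℕ v))) (sum-cong-≋ {N} monomial)) ⟩
        x * d * y + sum {N} (λ v → x ^ (2 ℕ.+ toℕ (opposite v)) * β (toℕ v) * y ^ (2 ℕ.+ toℕ v)) ∎

    -- Index k stands for the exponent k + 1. The exponent 1 is paired with itself by the monomial x
    -- y, and the exponents from 2 to p - 1 are paired so as to add up to p + 1.
    M : Fin (suc N) → Fin (suc N) → Carrier
    M zero    zero    = d
    M zero    (suc v) = 0#
    M (suc u) zero    = 0#
    M (suc u) (suc v) = antidiagonal (β ∘ toℕ) u v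

    -- Reversal exchanges the two correction terms, whose coefficients `c 0` and `c (3 + N)` are
    -- equal.
    β-palindrome : ∀ i j → i ℕ.+ j ≡ h ℕ.+ h → β i ≈ β j
    β-palindrome i j i+j≡h+h = begin
      c (2 ℕ.+ i) + (κ 0 i * c (3 ℕ.+ N) + κ (h ℕ.+ h) i * c 0)
        ≈⟨ +-cong (c-palindrome (2 ℕ.+ i) (2 ℕ.+ j)
             (≡.trans (move i j) (≡.trans (≡.cong (4 ℕ.+_) i+j≡h+h) (≡.sym n+n≡3+N))))
             (+-cong (*-cong (reflexive (≡.sym κj)) c-ends) (*-cong (reflexive κi) (sym c-ends))) ⟩
      c (2 ℕ.+ j) + (κ (h ℕ.+ h) j * c 0 + κ 0 j * c (3 ℕ.+ N))
        ≈⟨ +-congˡ (+-comm _ _) ⟩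
      c (2 ℕ.+ j) + (κ 0 j * c (3 ℕ.+ N) + κ (h ℕ.+ h) j * c 0) ∎
      where
      move : ∀ i j → suc (suc i) ℕ.+ suc (suc j) ≡ 4 ℕ.+ (i ℕ.+ j)
      move = ℕ-RingSolver.solve-∀
      c-ends : c (3 ℕ.+ N) ≈ c 0
      c-ends = c-palindrome (3 ℕ.+ N) 0 (≡.trans (ℕ.+-identityʳ (3 ℕ.+ N)) (≡.sym n+n≡3+N))
      κi : κ (h ℕ.+ h) i ≡ κ 0 j
      κi = ≡.trans (≡.cong (λ e → κ e i) (≡.sym i+j≡h+h)) (κ-+ i j)
      κj : κ (h ℕ.+ h) j ≡ κ 0 i
      κj = ≡.trans (≡.cong (λ e → κ e j) (≡.trans (≡.sym i+j≡h+h) (ℕ.+-comm i j))) (κ-+ j i)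

    -- For h > 0 the middle index differs from 0 and 2 h, the only places with a correction.
    β-centre : 0 < h → β h ≈ c n
    β-centre 0<h = begin
      c (2 ℕ.+ h) + (κ 0 h * c (3 ℕ.+ N) + κ (h ℕ.+ h) h * c 0)
        ≈⟨ +-cong (reflexive (≡.cong c (≡.sym n≡2+h)))
             (+-cong (trans (*-congʳ (reflexive (κ-0 0<h))) (zeroˡ _))
                     (trans (*-congʳ (reflexive (≡.trans (κ-+ h h) (κ-0 0<h)))) (zeroˡ _))) ⟩
      c n + (0# + 0#)  ≈⟨ +-congˡ (+-identityˡ 0#) ⟩
      c n + 0#         ≈⟨ +-identityʳ (c n) ⟩
      c n              ∎
      where
      κ-0 : ∀ {k} → 0 < k → κ 0 k ≡ 0#
      κ-0 (s≤s _) = ≡.refl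

    det-M : 0 < h → c 1 + c 1 ≈ 1# → ∃[ w ] det M ≈ (w * w) * ((- 1#) ^ h * c n)
    det-M 0<h 2c₁≈1 = w , (begin
      det M
        ≈⟨ det-bordered M (λ _ → refl) ⟩
      d * det (antidiagonal {N} (β ∘ toℕ))
        ≈⟨ *-cong d≈1 (det-antidiagonal {N} (β ∘ toℕ)) ⟩
      1# * (reversalSign N * product {N} (β ∘ toℕ))
        ≈⟨ *-identityˡ _ ⟩
      reversalSign N * product {N} (β ∘ toℕ)
        ≈⟨ *-cong (reversalSign-odd h) (trans (proj₂ palindrome) (*-congˡ (β-centre 0<h))) ⟩
      (- 1#) ^ h * ((w * w) * c n)
        ≈⟨ solve 3 (λ s w t → s :* (w :* t) := w :* (s :* t)) refl ((- 1#) ^ h) (w * w) (c n) ⟩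
      (w * w) * ((- 1#) ^ h * c n) ∎)
      where
      palindrome = product-palindrome h β β-palindrome
      w = proj₁ palindrome
      d≈1 : d ≈ 1#
      d≈1 = trans (+-congˡ (c-palindrome (2 ℕ.+ N) 1 (≡.trans (ℕ.+-comm (2 ℕ.+ N) 1) (≡.sym n+n≡3+N)))) 2c₁≈1

    module _ (a : Fin (suc N) → Carrier) (a^[1+N]≈1 : ∀ i → a i ^ suc N ≈ 1#) where

      powers : Fin (suc N) → Fin (suc N) → Carrier
      powers i k = a i ^ suc (toℕ k)

      powers⊛M-zero : ∀ i → (powers ⊛ M) i zero ≈ a i * d
      powers⊛M-zero i = begin
        a i * 1# * d + sum {N} (λ u → powers i (suc u) * 0#)
          ≈⟨ +-cong (*-congʳ (*-identityʳ (a i))) (sum-zeroʳ {N} (powers i ∘ suc)) ⟩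
        a i * d + 0#  ≈⟨ +-identityʳ (a i * d) ⟩
        a i * d       ∎

      powers⊛M-suc : ∀ i v → (powers ⊛ M) i (suc v) ≈ a i ^ (2 ℕ.+ toℕ (opposite v)) * β (toℕ v)
      powers⊛M-suc i v = begin
        a i * 1# * 0# + sum {N} (λ u → powers i (suc u) * (δ (opposite u) v * β (toℕ v)))
          ≈⟨ +-cong (zeroʳ _) (sum-cong-≋ {N} λ u → trans
               (*-congˡ (*-congʳ (reflexive (δ-opposite u v))))
               (solve 3 (λ a b c → a :* (b :* c) := a :* c :* b) refl
                 (powers i (suc u)) (δ u (opposite v)) (β (toℕ v)))) ⟩
        0# + sum {N} (λ u → powers i (suc u) * β (toℕ v) * δ u (opposite v))
          ≈⟨ +-identityˡ _ ⟩
        sum {N} (λ u → powers i (suc u) * β (toℕ v) * δ u (opposite v))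
          ≈⟨ sum-δ {N} (λ u → powers i (suc u) * β (toℕ v)) (opposite v) ⟩
        a i ^ (2 ℕ.+ toℕ (opposite v)) * β (toℕ v) ∎

      factorisation : ∀ i j → quadratic (a i) (a j) ^ n ≈ ((powers ⊛ M) ⊛ flip powers) i j
      factorisation i j = begin
        quadratic (a i) (a j) ^ n
          ≈⟨ quadratic-power (a^[1+N]≈1 i) (a^[1+N]≈1 j) ⟩
        a i * d * a j + sum {N} (λ v → a i ^ (2 ℕ.+ toℕ (opposite v)) * β (toℕ v) * a j ^ (2 ℕ.+ toℕ v))
          ≈⟨ +-cong (*-cong (powers⊛M-zero i) (*-identityʳ (a j)))
               (sum-cong-≋ {N} λ v → *-congʳ {a j ^ (2 ℕ.+ toℕ v)} (powers⊛M-suc i v)) ⟨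
        (powers ⊛ M) i zero * (a j * 1#) + sum {N} (λ v → (powers ⊛ M) i (suc v) * a j ^ (2 ℕ.+ toℕ v)) ∎

      det-quadratic-powers : 0 < h → c 1 + c 1 ≈ 1# →
        ∃[ w ] det (λ i j → quadratic (a i) (a j) ^ n) ≈ (w * w) * ((- 1#) ^ h * c n)
      det-quadratic-powers 0<h 2c₁≈1 = det powers * proj₁ det-M′ ,
        trans (det-congruence powers M factorisation)
          (rescale (det powers) (det M) (proj₁ det-M′) ((- 1#) ^ h * c n) (proj₂ det-M′))
        where
        det-M′ = det-M 0<h 2c₁≈1
        rescale : ∀ v m w t → m ≈ (w * w) * t → v * m * v ≈ (v * w * (v * w)) * t
        rescale v m w t m≈ = trans (*-congʳ (*-congˡ m≈))
          (solve 3 (λ v w t → v :* ((w :* w) :* t) :* v := (v :* w :* (v :* w)) :* t) refl v w t)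

-- The Legendre symbol of the determinant for p = 3 + 2 h with h > 0.

-- n stays a variable: at 2 + h the type checker would unfold (1 + X + X²) ^ᴾ n.
module LargePrime (h : ℕ) (0<h : 0 < h) (p-prime : Prime (3 ℕ.+ (h ℕ.+ h)))
                  (n : ℕ) (n≡2+h : n ≡ 2 ℕ.+ h) where
  private
    N p : ℕ
    N = suc (h ℕ.+ h)
    p = suc (suc N)

  open PrimeField p-prime
  open OddPrime h (≡.cong suc (≡.sym (ℕ.+-suc h h)))
  open Trinomials
  open PolynomialSums p
  open Determinants (𝔽 p) using (det-cong; -1^[h+h]≈1)
  open SemiringSum semiring using (sum)
  open QuadraticPowers (𝔽 p)
  open SetoidReasoning setoid

  c : ℕ → ℤ
  c = trinomial n

  n+n≡1+p : n ℕ.+ n ≡ suc p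
  n+n≡1+p = double-2+ h n≡2+h

  expansion : ∀ t → (1ℤ + t + t * t) ^ n ≈ sum {4 ℕ.+ N} λ k → c (toℕ k) * t ^ toℕ k
  expansion t = begin
    (1ℤ + t + t * t) ^ n   ≡⟨ ≡.cong (_^ n) (horner t) ⟩
    eval 1+X+X² t ^ n      ≡⟨ eval-^ 1+X+X² n t ⟨
    eval (1+X+X² ^ᴾ n) t   ≈⟨ eval-sum (4 ℕ.+ N) (1+X+X² ^ᴾ n) t vanishes ⟩
    sum {4 ℕ.+ N} (λ k → c (toℕ k) * t ^ toℕ k) ∎
    where
    horner : ∀ t → 1ℤ ℤ.+ t ℤ.+ t ℤ.* t ≡ 1ℤ ℤ.+ t ℤ.* (1ℤ ℤ.+ t ℤ.* (1ℤ ℤ.+ t ℤ.* 0ℤ))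
    horner = solve-∀
    vanishes : ∀ k → 4 ℕ.+ N ≤ k → c k ≡ 0ℤ
    vanishes k 4+N≤k = trinomial-vanishes n k (≡.subst (_< k) (≡.sym n+n≡1+p) 4+N≤k)

  c₁+c₁≈1 : c 1 + c 1 ≈ 1ℤ
  c₁+c₁≈1 = begin
    c 1 + c 1    ≡⟨ ≡.cong₂ ℤ._+_ (trinomial-1 n) (trinomial-1 n) ⟩
    + (n ℕ.+ n)  ≡⟨ ≡.cong +_ n+n≡1+p ⟩
    1ℤ + + p     ≈⟨ +-congˡ {1ℤ} p≈0 ⟩
    1ℤ           ∎

  -1^k^[1+k]≈1 : ∀ k → (-1ℤ ^ k) ^ suc k ≈ 1ℤ
  -1^k^[1+k]≈1 k = trans (^-assocʳ -1ℤ k (suc k)) (pronic k)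
    where
    pronic : ∀ k → -1ℤ ^ (k ℕ.* suc k) ≈ 1ℤ
    pronic zero    = refl
    pronic (suc k) = begin
      -1ℤ ^ (suc k ℕ.* suc (suc k))                      ≡⟨ ≡.cong (-1ℤ ^_) (step k) ⟩
      -1ℤ ^ (k ℕ.* suc k ℕ.+ (suc k ℕ.+ suc k))          ≈⟨ ^-homo-* -1ℤ (k ℕ.* suc k) (suc k ℕ.+ suc k) ⟩
      -1ℤ ^ (k ℕ.* suc k) * -1ℤ ^ (suc k ℕ.+ suc k)      ≈⟨ *-cong (pronic k) (-1^[h+h]≈1 (suc k)) ⟩
      1ℤ                                                 ∎
      where
      step : ∀ k → suc k ℕ.* suc (suc k) ≡ k ℕ.* suc k ℕ.+ (suc k ℕ.+ suc k)
      step = ℕ-RingSolver.solve-∀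

  legendre-square-multiple : ∀ x w t → x ≈ (w * w) * (-1ℤ ^ h * t) → ¬ (x ≈ 0ℤ) →
                             legendre p x ≡ legendre p t
  legendre-square-multiple x w t x≈ x≉0 = legendre-injective x t (begin
    legendre p x
      ≈⟨ euler x ⟩
    x ^ suc h
      ≈⟨ ^-congˡ (suc h) x≈ ⟩
    ((w * w) * (-1ℤ ^ h * t)) ^ suc h
      ≈⟨ ^-distrib-* (w * w) (-1ℤ ^ h * t) (suc h) ⟩
    (w * w) ^ suc h * (-1ℤ ^ h * t) ^ suc h
      ≈⟨ *-cong {(w * w) ^ suc h} {1ℤ} (square^m≈1 w≉0) (^-distrib-* (-1ℤ ^ h) t (suc h)) ⟩
    1ℤ * ((-1ℤ ^ h) ^ suc h * t ^ suc h)
      ≈⟨ *-identityˡ ((-1ℤ ^ h) ^ suc h * t ^ suc h) ⟩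
    (-1ℤ ^ h) ^ suc h * t ^ suc h
      ≈⟨ *-congʳ {t ^ suc h} (-1^k^[1+k]≈1 h) ⟩
    1ℤ * t ^ suc h
      ≈⟨ *-identityˡ (t ^ suc h) ⟩
    t ^ suc h
      ≈⟨ euler t ⟨
    legendre p t ∎)
    where
    w≉0 : ¬ (w ≈ 0ℤ)
    w≉0 w≈0 = x≉0 (begin
      x                          ≈⟨ x≈ ⟩
      (w * w) * (-1ℤ ^ h * t)    ≈⟨ *-congʳ { -1ℤ ^ h * t} (*-congʳ {w} w≈0) ⟩
      (0ℤ * w) * (-1ℤ ^ h * t)   ≈⟨ *-congʳ { -1ℤ ^ h * t} (zeroˡ w) ⟩
      0ℤ * (-1ℤ ^ h * t)         ≈⟨ zeroˡ (-1ℤ ^ h * t) ⟩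
      0ℤ                         ∎)

  module _ (a : Fin (suc N) → ℤ) (a≉0 : ∀ i → ¬ (a i ≈ 0ℤ)) where

    quadratic-legendre : ∀ i j → S p a i j ≈ quadratic (a i) (a j) ^ n
    quadratic-legendre i j = begin
      quadratic (a i) (a j) * legendre p (quadratic (a i) (a j))
        ≈⟨ *-congˡ {quadratic (a i) (a j)} (euler (quadratic (a i) (a j))) ⟩
      quadratic (a i) (a j) ^ suc (suc h)
        ≡⟨ ≡.cong (quadratic (a i) (a j) ^_) n≡2+h ⟨
      quadratic (a i) (a j) ^ n ∎

    detS-factorisation : ∃[ w ] detS p a ≈ (w * w) * (-1ℤ ^ h * T n)
    detS-factorisation = proj₁ factors , trans (det-cong quadratic-legendre) (proj₂ factors)
      where
      factors = det-quadratic-powers h n n≡2+h c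
        (λ i j i+j≡n+n → reflexive (trinomial-palindrome n i j i+j≡n+n)) expansion
        a (λ i → fermat-≉0 (a≉0 i)) 0<h c₁+c₁≈1

    legendre-detS : ¬ (detS p a ≈ 0ℤ) → legendre p (detS p a) ≡ legendre p (T n)
    legendre-detS = legendre-square-multiple (detS p a) (proj₁ detS-factorisation) (T n) (proj₂ detS-factorisation)

-- From odd primes to the shape 3 + 2 h.

odd⇒1+k+k : ∀ p → ¬ (2 ∣ p) → ∃[ k ] p ≡ suc (k ℕ.+ k)
odd⇒1+k+k p 2∤p with p ℕ.% 2 in r≡ | m%n<n p 2 | m≡m%n+[m/n]*n p 2
... | zero        | _ | eq = ⊥-elim (2∤p (divides (p ℕ./ 2) eq))
... | suc zero    | _ | eq = p ℕ./ 2 , ≡.trans eq (≡.cong suc (double (p ℕ./ 2)))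
  where
  double : ∀ k → k ℕ.* 2 ≡ k ℕ.+ k
  double = ℕ-RingSolver.solve-∀
... | suc (suc _) | s≤s (s≤s ()) | _

legendre-detS-odd : ∀ k p → p ≡ suc (k ℕ.+ k) → Prime p → p ≢ 3 →
  (a : Fin (p ∸ 1) → ℤ) → ListsNonzero p a → ¬ (detS p a ≡ 0ℤ [mod p ]) →
  legendre p (detS p a) ≡ legendre p (T (suc k))
legendre-detS-odd zero          p ≡.refl p-prime p≢3 = ⊥-elim (¬prime[1] p-prime)
legendre-detS-odd (suc zero)    p ≡.refl p-prime p≢3 = ⊥-elim (p≢3 ≡.refl)
legendre-detS-odd (suc (suc g)) p p≡     p-prime p≢3 =
  helper (≡.trans p≡ (≡.cong (λ k → suc (suc k)) (ℕ.+-suc (suc g) (suc g)))) p-prime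
  where
  -- With h = g + 1 this is p = 3 + 2 h. The type of `a` depends on `p`, so `p` is generalised
  -- together with `a` before the equation is matched.
  helper : ∀ {p} → p ≡ suc (suc (suc (suc g ℕ.+ suc g))) → Prime p →
    (a : Fin (p ∸ 1) → ℤ) → ListsNonzero p a → ¬ (detS p a ≡ 0ℤ [mod p ]) →
    legendre p (detS p a) ≡ legendre p (T (suc (suc (suc g))))
  helper ≡.refl p-prime a lists det≉0 =
    LargePrime.legendre-detS (suc g) (s≤s z≤n) p-prime (suc (suc (suc g))) ≡.refl
      a (ListsNonzero.nonzero lists) det≉0

open import Data.Nat using (_+_; _/_)

corollary1 : (p : ℕ) → Prime p → ¬ (2 ∣ p) → p ≢ 3 →
    (a : Fin (p ∸ 1) → ℤ) → ListsNonzero p a →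
    ¬ (detS p a ≡ 0ℤ [mod p ]) →
    legendre p (detS p a) ≡ legendre p (T ((p + 1) / 2))
corollary1 p p-prime 2∤p p≢3 a lists det≉0 =
  ≡.trans (legendre-detS-odd (proj₁ odd) p (proj₂ odd) p-prime p≢3 a lists det≉0)
    (≡.cong (λ n → legendre p (T n)) (≡.sym half))
  where
  odd = odd⇒1+k+k p 2∤p
  k = proj₁ odd
  half : (p + 1) / 2 ≡ suc k
  half = ≡.trans (≡.cong (λ q → (q + 1) / 2) (proj₂ odd))
           (≡.trans (≡.cong (_/ 2) (twice k)) (m*n/n≡m (suc k) 2))
    where
    twice : ∀ k → suc (k + k) + 1 ≡ suc k ℕ.* 2
    twice = ℕ-RingSolver.solve-∀
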